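{- For every choice of constants $\varepsilon>0$ and $C \ge 1$ there exists $N=N(\varepsilon,C) \in \mathbb{N}$ such that for all integers $s,t$ with $N \le s \le t \le Cs$ there exists a graph $G$ that does not contain $K_{s,t}$ as a minor and whose list chromatic number satisfies $\chi_\ell(G) > (1-\varepsilon)(2s+t)$.
   Context: All graphs are finite, loopless and without parallel edges. $K_{s,t}$ denotes the complete bipartite graph with bipartition classes of sizes $s$ and $t$. A graph $G$ contains $F$ as a minor if there are pairwise disjoint non-empty sets $(Z_f)_{f\in V(F)}$ of vertices of $G$ such that each $G[Z_f]$ is connected and for every edge $f_1f_2$ of $F$ there is an edge of $G$ between $Z_{f_1}$ and $Z_{f_2}$. The list chromatic number $\chi_\ell(G)$ is the smallest $k\ge 1$ such that for every assignment of finite lists $L(v)\subseteq\mathbb{N}$ with $|L(v)|\ge k$ for all $v$, there is a proper coloring $c$ of $G$ with $c(v)\in L(v)$ for all $v$. -}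

module Defs where

open import Level using (0ℓ)
open import Data.Nat as ℕ using (ℕ; _+_)
open import Data.Fin using (Fin; toℕ)
open import Data.List using (List; length)
open import Data.List.Membership.Propositional using (_∈_)
open import Data.List.Relation.Unary.Unique.Propositional using (Unique)
open import Data.Product using (Σ; ∃; _×_)
open import Data.Sum using (_⊎_)
open import Relation.Nullary using (¬_)
import Data.Nat.Properties
open import Relation.Binary.PropositionalEquality using (_≡_; _≢_)
open import Data.Integer using (+_)
open import Data.Rational as ℚ using (ℚ; _/_)

record Graph : Set₁ where
  field
    n     : ℕ
    Adj   : Fin n → Fin n → Set
    sym   : ∀ {u v} → Adj u v → Adj v u
    irrefl : ∀ {v} → ¬ Adj v v
open Graph public

K : ℕ → ℕ → Graph
K s t = record
  { n = s + t
  ; Adj = adj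
  ; sym = symm
  ; irrefl = irr
  }
  where
  adj : Fin (s + t) → Fin (s + t) → Set
  adj i j = (toℕ i ℕ.< s × s ℕ.≤ toℕ j) ⊎ (s ℕ.≤ toℕ i × toℕ j ℕ.< s)
  symm : ∀ {u v} → adj u v → adj v u
  symm (Data.Sum.inj₁ (a Data.Product., b)) = Data.Sum.inj₂ (b Data.Product., a)
  symm (Data.Sum.inj₂ (a Data.Product., b)) = Data.Sum.inj₁ (b Data.Product., a)
  irr : ∀ {v} → ¬ adj v v
  irr (Data.Sum.inj₁ (a Data.Product., b)) = Data.Nat.Properties.<⇒≱ a b
  irr (Data.Sum.inj₂ (a Data.Product., b)) = Data.Nat.Properties.<⇒≱ b a

data WalkIn (G : Graph) (P : Fin (n G) → Set) : Fin (n G) → Fin (n G) → Set where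
  here : ∀ {u} → P u → WalkIn G P u u
  step : ∀ {u w v} → P u → Adj G u w → WalkIn G P w v → WalkIn G P u v

Connected : (G : Graph) → (Fin (n G) → Set) → Set
Connected G P = ∀ u v → P u → P v → WalkIn G P u v

record MinorModel (F G : Graph) : Set₁ where
  field
    Z          : Fin (n F) → Fin (n G) → Set
    disjoint   : ∀ f g v → Z f v → Z g v → f ≡ g
    nonempty   : ∀ f → ∃ λ v → Z f v
    connected  : ∀ f → Connected G (Z f)
    edges      : ∀ f₁ f₂ → Adj F f₁ f₂ →
                 ∃ λ u → ∃ λ v → Z f₁ u × Z f₂ v × Adj G u v

HasMinor : Graph → Graph → Set₁
HasMinor G F = MinorModel F G

Proper : (G : Graph) → (Fin (n G) → ℕ) → Set
Proper G c = ∀ u v → Adj G u v → c u ≢ c v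

-- G is k-choosable: for every assignment of finite lists (finite sets of
-- naturals, represented as duplicate-free lists) of size ≥ k there is a
-- proper colouring from the lists.
Choosable : Graph → ℕ → Set
Choosable G k =
  (L : Fin (n G) → List ℕ) →
  (∀ v → Unique (L v)) →
  (∀ v → k ℕ.≤ length (L v)) →
  Σ (Fin (n G) → ℕ) λ c → (∀ v → c v ∈ L v) × Proper G c

IsListChromaticNumber : Graph → ℕ → Set
IsListChromaticNumber G k =
  1 ℕ.≤ k × Choosable G k × (∀ j → 1 ℕ.≤ j → Choosable G j → k ℕ.≤ j)

ℕtoℚ : ℕ → ℚ
ℕtoℚ m = + m / 1

{-# OPTIONS --safe #-}
-- Take cliques A and B of sizes just below s and s + t, and join all pairs between them except
-- a pseudorandom sparse set R.  Glue one copy of B to A for every colouring x of A from a palette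
-- with |A| + |B| - 1 colours, and delete from the list of a vertex b of copy x the colours x(a)
-- with R a b.  In the copy belonging to the colouring actually used on A, all of A and B must
-- receive different colours, which is impossible; sparsity of R keeps the lists long.
--
-- In a K_{s,t}-minor fewer than s branch sets meet A, so the branch sets avoiding A all lie in one
-- copy of B, with linearly many on each side.  Fewer than s + t branch sets meet that copy, so on
-- one side linearly many avoid it.  Most of these sets have bounded size, and then pseudorandomness
-- gives a branch set of one side and one of the other that are completely non-adjacent.
--
-- R is obtained from a colouring of A × B with q colours: R a b holds when the pair has the colour
-- that is rarest in the row of b.  A union bound over all families of small sets and all choices
-- of target colours shows that a suitable colouring exists.

module Submission where

module Combinatorics where

  open import Defs hiding (sym; n)
  open import Data.Nat using (ℕ; zero; suc; _+_; _*_; _∸_; _^_; _/_; _%_; _≤_; _<_; _≤?_; _<?_; z≤n; s≤s; s≤s⁻¹; NonZero; >-nonZero)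
  open import Data.Nat.Properties hiding (suc-injective)
  open import Data.Nat.DivMod using (m/n*n≤m; m≡m%n+[m/n]*n; m%n<n; m*n/n≡m; /-monoˡ-≤)
  open import Data.Nat.Tactic.RingSolver using (solve-∀)
  open import Data.Bool using (Bool; true; false)
  import Data.Bool.Properties as Bool
  open import Data.Fin using (Fin; zero; suc; toℕ; _↑ˡ_; _↑ʳ_; splitAt; join; combine; remQuot; quotient; remainder; punchIn; finToFun; funToFin)
  open import Data.Fin.Properties using (all?; any?; suc-injective; toℕ-injective; toℕ<n; toℕ-↑ˡ; toℕ-↑ʳ; ↑ˡ-injective; ↑ʳ-injective; splitAt-↑ˡ; splitAt-↑ʳ; splitAt⁻¹-↑ˡ; splitAt⁻¹-↑ʳ; join-splitAt; remQuot-combine; combine-remQuot; combine-surjective; combine-injective; finToFun-funToFin; punchInᵢ≢i; pigeonhole) renaming (_≟_ to _≟F_)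
  open import Data.List using (List; length; map; filter; tabulate; allFin)
  open import Data.List.Properties using (length-map)
  open import Data.List.Membership.Propositional using (_∈_)
  open import Data.List.Membership.Propositional.Properties using (∈-map⁻; ∈-filter⁻)
  open import Data.List.Relation.Unary.Unique.Propositional using (Unique)
  import Data.List.Relation.Unary.Unique.Propositional.Properties as Unique
  open import Data.Product using (Σ; ∃; ∃₂; _×_; _,_; proj₁; proj₂)
  open import Data.Sum using (_⊎_; inj₁; inj₂; [_,_]′)
  open import Data.Unit using (⊤; tt)
  open import Data.Empty using (⊥)
  open import Data.Vec.Functional using ([]; _∷_; updateAt; removeAt)
  open import Data.Vec.Functional.Properties using (updateAt-updates; updateAt-minimal)
  open import Function using (_∘_; const)
  open import Relation.Nullary using (¬_; Dec; yes; no; contradiction)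
  open import Relation.Nullary.Decidable using (_×-dec_; _⊎-dec_; ¬?; ¬¬-excluded-middle)
  open import Relation.Binary.PropositionalEquality using (_≡_; _≢_; refl; sym; trans; cong; cong₂; subst; subst₂)
  open import Algebra.Properties.Semiring.Sum +-*-semiring using (sum; ∑-comm; ∑-distrib-+; sum-cong-≗; *-distribˡ-sum; *-distribʳ-sum)
  open import Algebra.Properties.CommutativeMonoid.Sum *-1-commutativeMonoid using () renaming (sum to prod; sum-remove to prod-remove; sum-cong-≗ to prod-cong)

  -- Finite cardinalities

  ind : {A : Set} → Dec A → ℕ
  ind (yes _) = 1
  ind (no _)  = 0

  ind-yes : {A : Set} (a? : Dec A) → A → ind a? ≡ 1
  ind-yes (yes _) _ = refl
  ind-yes (no ¬a) a = contradiction a ¬a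

  ind-no : {A : Set} (a? : Dec A) → ¬ A → ind a? ≡ 0
  ind-no (yes a) ¬a = contradiction a ¬a
  ind-no (no _)  _  = refl

  ind-mono : {A B : Set} (a? : Dec A) (b? : Dec B) → (A → B) → ind a? ≤ ind b?
  ind-mono (yes a) b? f = ≤-reflexive (sym (ind-yes b? (f a)))
  ind-mono (no _)  b? f = z≤n

  ind-× : {A B : Set} (a? : Dec A) (b? : Dec B) → ind (a? ×-dec b?) ≡ ind a? * ind b?
  ind-× (yes _) (yes _) = refl
  ind-× (yes _) (no _)  = refl
  ind-× (no _)  _       = refl

  sum-mono : ∀ {n} {f g : Fin n → ℕ} → (∀ i → f i ≤ g i) → sum f ≤ sum g
  sum-mono {zero}  f≤g = z≤n
  sum-mono {suc n} f≤g = +-mono-≤ (f≤g zero) (sum-mono (f≤g ∘ suc))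

  sum-const : ∀ n c → sum {n} (λ _ → c) ≡ n * c
  sum-const zero    c = refl
  sum-const (suc n) c = cong (c +_) (sum-const n c)

  term≤sum : ∀ {n} (f : Fin n → ℕ) i → f i ≤ sum f
  term≤sum f zero    = m≤m+n _ _
  term≤sum f (suc i) = ≤-trans (term≤sum (f ∘ suc) i) (m≤n+m _ _)

  sum-ones : ∀ n → sum {n} (λ _ → 1) ≡ n
  sum-ones n = trans (sum-const n 1) (*-identityʳ n)

  sum-↑ : ∀ {m n} (f : Fin (m + n) → ℕ) →
          sum f ≡ sum (λ i → f (i ↑ˡ n)) + sum (λ j → f (m ↑ʳ j))
  sum-↑ {zero}  f = refl
  sum-↑ {suc m} f = trans (cong (f zero +_) (sum-↑ {m} (f ∘ suc))) (sym (+-assoc (f zero) _ _))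

  sum-combine : ∀ {m n} (f : Fin (m * n) → ℕ) →
                sum f ≡ sum (λ i → sum (λ j → f (combine {m} {n} i j)))
  sum-combine {zero}      f = refl
  sum-combine {suc m} {n} f =
    trans (sum-↑ {n} f) (cong (sum (λ j → f (j ↑ˡ (m * n))) +_) (sum-combine {m} (λ k → f (n ↑ʳ k))))

  -- Averaging. `count-average` applies it coordinate by coordinate to find a colouring,
  -- `rare-value` to find a rare colour.
  sum-average : ∀ {n} (f : Fin n → ℕ) c → sum f < n * c → ∃ λ i → f i < c
  sum-average {suc n} f c lt with f zero <? c
  ... | yes p = zero , p
  ... | no ¬p with sum-average (f ∘ suc) c
                     (+-cancelˡ-< c _ _ (≤-<-trans (+-monoˡ-≤ _ (≮⇒≥ ¬p)) lt))
  ...   | i , q = suc i , q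

  sum-ind-unique : ∀ {n} {P : Fin n → Set} (P? : ∀ i → Dec (P i)) →
                   (∀ i j → P i → P j → i ≡ j) → sum (λ i → ind (P? i)) ≤ 1
  sum-ind-unique {zero}  P? u = z≤n
  sum-ind-unique {suc n} P? u with P? zero
  ... | no _  = sum-ind-unique (P? ∘ suc) (λ i j p p′ → suc-injective (u _ _ p p′))
  ... | yes p = s≤s (≤-trans (sum-mono {g = λ _ → 0} none) (≤-reflexive (trans (sum-const n 0) (*-zeroʳ n))))
    where
    none : ∀ i → ind (P? (suc i)) ≤ 0
    none i = ≤-reflexive (ind-no (P? (suc i)) (λ p′ → contradiction (u _ _ p p′) λ ()))

  card : ∀ {n} {P : Fin n → Set} → (∀ i → Dec (P i)) → ℕ
  card P? = sum (λ i → ind (P? i))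

  card-positive⇒∃ : ∀ {n} {P : Fin n → Set} (P? : ∀ i → Dec (P i)) → 1 ≤ card P? → ∃ P
  card-positive⇒∃ {suc n} P? le with P? zero
  ... | yes p = zero , p
  ... | no _ with card-positive⇒∃ (P? ∘ suc) le
  ...   | i , p = suc i , p

  ∃⇒card-positive : ∀ {n} {P : Fin n → Set} (P? : ∀ i → Dec (P i)) → ∃ P → 1 ≤ card P?
  ∃⇒card-positive P? (i , p) =
    ≤-trans (≤-reflexive (sym (ind-yes (P? i) p))) (term≤sum (λ i → ind (P? i)) i)

  -- Turns a count into an injective list of exactly `m` witnesses, so that the surviving branch
  -- sets can be reindexed by `Fin m`.
  enumerate : ∀ {n} {P : Fin n → Set} (P? : ∀ i → Dec (P i)) m → m ≤ card P? →
              Σ (Fin m → Fin n) λ ι → (∀ i → P (ι i)) × (∀ i j → ι i ≡ ι j → i ≡ j)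
  enumerate P? zero le = (λ ()) , (λ ()) , λ ()
  enumerate {suc n} P? (suc m) le with P? zero
  ... | no _ with enumerate (P? ∘ suc) (suc m) le
  ...   | ι , all , inj = suc ∘ ι , all , λ i j eq → inj i j (suc-injective eq)
  enumerate {suc n} {P} P? (suc m) (s≤s le) | yes p with enumerate (P? ∘ suc) m le
  ...   | ι , all , inj = ι′ , all′ , inj′
    where
    ι′ : Fin (suc m) → Fin (suc n)
    ι′ zero    = zero
    ι′ (suc i) = suc (ι i)
    all′ : ∀ i → P (ι′ i)
    all′ zero    = p
    all′ (suc i) = all i
    inj′ : ∀ i j → ι′ i ≡ ι′ j → i ≡ j
    inj′ zero    zero    _  = refl
    inj′ (suc i) (suc j) eq = cong suc (inj i j (suc-injective eq))

  module Family {ℓ a : ℕ} {Z : Fin ℓ → Fin a → Set} (Z? : ∀ f x → Dec (Z f x)) where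

    size : Fin ℓ → ℕ
    size f = card (Z? f)

    module _ (disjoint : ∀ f g x → Z f x → Z g x → f ≡ g) where

      sum-size≤ : sum size ≤ a
      sum-size≤ = begin
        sum size                          ≡⟨ ∑-comm (λ f x → ind (Z? f x)) ⟩
        sum (λ x → card (λ f → Z? f x))   ≤⟨ sum-mono (λ x → sum-ind-unique (λ f → Z? f x) (λ f g → disjoint f g x)) ⟩
        sum {a} (λ _ → 1)                 ≡⟨ sum-ones a ⟩
        a                                 ∎
        where open ≤-Reasoning

    -- Markov's inequality. With `h` equal to 1 it counts the sets that meet the ground set at all,
    -- with `h` equal to `suc k` those with more than `k` elements.
    large*h≤ : ∀ h → card (λ f → h ≤? size f) * h ≤ sum size
    large*h≤ h = begin
      card (λ f → h ≤? size f) * h           ≡⟨ *-distribʳ-sum h (λ f → ind (h ≤? size f)) ⟩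
      sum (λ f → ind (h ≤? size f) * h)      ≤⟨ sum-mono (λ f → bound f (h ≤? size f)) ⟩
      sum size                               ∎
      where
      open ≤-Reasoning
      bound : ∀ f (d : Dec (h ≤ size f)) → ind d * h ≤ size f
      bound f (yes p) = ≤-trans (≤-reflexive (+-identityʳ h)) p
      bound f (no _)  = z≤n

    few-large : ∀ {total h m} .{{_ : NonZero h}} → sum size ≤ total → total ≤ m * h →
                card (λ f → h ≤? size f) ≤ m
    few-large {h = h} size≤total total≤mh =
      *-cancelʳ-≤ _ _ h (≤-trans (large*h≤ h) (≤-trans size≤total total≤mh))

  card-complement : ∀ {n} {P : Fin n → Set} (P? : ∀ i → Dec (P i)) →
                    n ≤ card (λ i → ¬? (P? i)) + card P?
  card-complement {n} P? = begin
    n                                             ≡⟨ sum-ones n ⟨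
    sum {n} (λ _ → 1)                             ≤⟨ sum-mono (λ i → cover (P? i)) ⟩
    sum (λ i → ind (¬? (P? i)) + ind (P? i))      ≡⟨ ∑-distrib-+ (λ i → ind (¬? (P? i))) (λ i → ind (P? i)) ⟩
    card (λ i → ¬? (P? i)) + card P?              ∎
    where
    open ≤-Reasoning
    cover : ∀ {A : Set} (a? : Dec A) → 1 ≤ ind (¬? a?) + ind a?
    cover (yes _) = s≤s z≤n
    cover (no _)  = s≤s z≤n

  card-diff : ∀ {n} {P Q : Fin n → Set} (P? : ∀ i → Dec (P i)) (Q? : ∀ i → Dec (Q i)) →
              card P? ≤ card (λ i → P? i ×-dec ¬? (Q? i)) + card Q?
  card-diff P? Q? = begin
    card P?                                       ≤⟨ sum-mono (λ i → cover (P? i) (Q? i)) ⟩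
    sum (λ i → ind (P? i ×-dec ¬? (Q? i)) + ind (Q? i))
                                                  ≡⟨ ∑-distrib-+ (λ i → ind (P? i ×-dec ¬? (Q? i))) (λ i → ind (Q? i)) ⟩
    card (λ i → P? i ×-dec ¬? (Q? i)) + card Q?   ∎
    where
    open ≤-Reasoning
    cover : ∀ {A B : Set} (a? : Dec A) (b? : Dec B) → ind a? ≤ ind (a? ×-dec ¬? b?) + ind b?
    cover (yes _) (yes _) = s≤s z≤n
    cover (yes _) (no _)  = s≤s z≤n
    cover (no _)  _       = z≤n

  ind-any≤card : ∀ {n} {P : Fin n → Set} (P? : ∀ i → Dec (P i)) → ind (any? P?) ≤ card P?
  ind-any≤card P? with any? P?
  ... | yes p = ∃⇒card-positive P? p
  ... | no _  = z≤n

  -- Counting colourings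

  prod-const : ∀ n c → prod {n} (λ _ → c) ≡ c ^ n
  prod-const zero    c = refl
  prod-const (suc n) c = cong (c *_) (prod-const n c)

  -- The product of the factors other than the one at `p`. The empty case has no index, so `n` may
  -- stay a variable where `removeAt` asks for a successor.
  rest : ∀ {n} → (Fin n → ℕ) → Fin n → ℕ
  rest {suc n} g p = prod (removeAt g p)

  prod≡*rest : ∀ {n} (g : Fin n → ℕ) p → prod g ≡ g p * rest g p
  prod≡*rest {suc n} g p = prod-remove g

  rest-cong : ∀ {n} (g h : Fin n → ℕ) p → (∀ j → j ≢ p → g j ≡ h j) → rest g p ≡ rest h p
  rest-cong {suc n} g h p eq = prod-cong (λ j → eq (punchIn p j) (punchInᵢ≢i p j))

  module Colourings (q-1 : ℕ) where

    q : ℕ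
    q = suc q-1

    -- The total of `f` over all `q ^ n` colourings, that is, `q ^ n` times its mean. Nesting the
    -- sums allows positions to be revealed one at a time.
    count : ∀ n → ((Fin n → Fin q) → ℕ) → ℕ
    count zero    f = f []
    count (suc n) f = sum (λ x → count n (λ ω → f (x ∷ ω)))

    count-mono : ∀ n {f g : (Fin n → Fin q) → ℕ} → (∀ ω → f ω ≤ g ω) → count n f ≤ count n g
    count-mono zero    f≤g = f≤g []
    count-mono (suc n) f≤g = sum-mono (λ x → count-mono n (λ ω → f≤g (x ∷ ω)))

    count-zero : ∀ n → count n (λ _ → 0) ≡ 0
    count-zero zero    = refl
    count-zero (suc n) = trans (sum-cong-≗ {q} (λ _ → count-zero n)) (trans (sum-const q 0) (*-zeroʳ q))

    count-sum : ∀ n {E} (f : Fin E → (Fin n → Fin q) → ℕ) →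
                sum (λ e → count n (f e)) ≡ count n (λ ω → sum (λ e → f e ω))
    count-sum zero    f = refl
    count-sum (suc n) f =
      trans (∑-comm (λ e x → count n (λ ω → f e (x ∷ ω))))
            (sum-cong-≗ (λ x → count-sum n (λ e ω → f e (x ∷ ω))))

    count-average : ∀ n (f : (Fin n → Fin q) → ℕ) → count n f < q ^ n → ∃ λ ω → f ω < 1
    count-average zero    f lt = [] , lt
    count-average (suc n) f lt with sum-average _ (q ^ n) lt
    ... | x , lt′ with count-average n _ lt′
    ...   | ω , r = x ∷ ω , r

    q^>0 : ∀ n → 1 ≤ q ^ n
    q^>0 n = m^n>0 q n

    -- Each `f e` has mean at most `u / v`, so their sum has mean below 1 and vanishes at some
    -- colouring. Denominators are cleared throughout.
    union-bound : ∀ n {E} (f : Fin E → (Fin n → Fin q) → ℕ) u v →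
                  (∀ e → count n (f e) * v ≤ q ^ n * u) → E * u < v →
                  ∃ λ ω → ∀ e → f e ω ≡ 0
    union-bound n {E} f u v bound lt with count-average n (λ ω → sum (λ e → f e ω)) few
      where
      open ≤-Reasoning
      few : count n (λ ω → sum (λ e → f e ω)) < q ^ n
      few = *-cancelʳ-< v _ _ (begin-strict
        count n (λ ω → sum (λ e → f e ω)) * v  ≡⟨ cong (_* v) (count-sum n f) ⟨
        sum (λ e → count n (f e)) * v          ≡⟨ *-distribʳ-sum v (λ e → count n (f e)) ⟩
        sum (λ e → count n (f e) * v)          ≤⟨ sum-mono bound ⟩
        sum {E} (λ _ → q ^ n * u)              ≡⟨ sum-const E (q ^ n * u) ⟩
        E * (q ^ n * u)                        ≡⟨ swap E (q ^ n) u ⟩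
        q ^ n * (E * u)                        <⟨ *-monoʳ-< (q ^ n) {{m^n≢0 q n}} lt ⟩
        q ^ n * v                              ∎)
        where
        swap : ∀ a b c → a * (b * c) ≡ b * (a * c)
        swap = solve-∀
    ... | ω , lt′ = ω , λ e → n<1⇒n≡0 (≤-<-trans (term≤sum (λ e → f e ω) e) lt′)

    -- A map κ : Fin n → Fin (suc P) groups the positions into P blocks; value zero
    -- means "in no block".  A block that is marked true has already been broken.
    Broken : ∀ {n P} → (Fin n → Fin (suc P)) → (Fin n → Fin q) → (Fin P → Bool) → (Fin n → Fin q) → Set
    Broken κ τ d ω = ∀ p → d p ≡ true ⊎ ∃ λ c → κ c ≡ suc p × ω c ≢ τ c

    Broken? : ∀ {n P} κ τ d ω → Dec (Broken {n} {P} κ τ d ω)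
    Broken? κ τ d ω = all? λ p → (d p Bool.≟ true) ⊎-dec any? λ c → (κ c ≟F suc p) ×-dec ¬? (ω c ≟F τ c)

    -- `q ^ r` times the probability that a block with `r` unseen positions ends up broken: 1 if it
    -- is marked already, and 1 minus `1 / q ^ r` otherwise.
    weight : Bool → ℕ → ℕ
    weight true  r = q ^ r
    weight false r = q ^ r ∸ 1

    mark : {A : Set} → Bool → Dec A → Bool
    mark b (yes _) = b
    mark b (no _)  = true

    mark-true : {A : Set} (a? : Dec A) → mark true a? ≡ true
    mark-true (yes _) = refl
    mark-true (no _)  = refl

    mark-no : {A : Set} (a? : Dec A) (b : Bool) → ¬ A → mark b a? ≡ true
    mark-no (yes a) b ¬a = contradiction a ¬a
    mark-no (no _)  b ¬a = refl

    -- Only the target value keeps an unbroken block unbroken, so `q - 1` terms `q ^ k` and one term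
    -- `q ^ k - 1` add up to `q ^ suc k - 1`.
    sum-weight : ∀ b (t : Fin q) k → sum (λ x → weight (mark b (x ≟F t)) k) ≡ weight b (suc k)
    sum-weight true  t k =
      trans (sum-cong-≗ (λ x → cong (λ b → weight b k) (mark-true (x ≟F t)))) (sum-const q (q ^ k))
    sum-weight false t k = sym (trans (cong (_∸ 1) (sym total)) (m+n∸n≡m S 1))
      where
      S = sum (λ x → weight (mark false (x ≟F t)) k)
      one : card (λ x → x ≟F t) ≡ 1
      one = ≤-antisym (sum-ind-unique (λ x → x ≟F t) (λ _ _ p p′ → trans p (sym p′)))
                      (∃⇒card-positive (λ x → x ≟F t) (t , refl))
      each : ∀ {A : Set} (a? : Dec A) → weight (mark false a?) k + ind a? ≡ q ^ k
      each (yes _) = m∸n+n≡m (q^>0 k)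
      each (no _)  = +-identityʳ _
      total : S + 1 ≡ q ^ suc k
      total = trans (cong (S +_) (sym one))
             (trans (sym (∑-distrib-+ (λ x → weight (mark false (x ≟F t)) k) (λ x → ind (x ≟F t))))
             (trans (sum-cong-≗ (λ x → each (x ≟F t))) (sum-const q (q ^ k))))

    -- A block with r unseen positions survives unbroken with probability q⁻ʳ; both sides
    -- are multiplied by the powers of q.  The induction reveals the positions one by one.
    count-broken : ∀ n {P} (κ : Fin n → Fin (suc P)) τ d (r : Fin P → ℕ) →
                   (∀ p → card (λ c → κ c ≟F suc p) ≤ r p) →
                   count n (λ ω → ind (Broken? κ τ d ω)) * prod (λ p → q ^ r p)
                     ≤ q ^ n * prod (λ p → weight (d p) (r p))
    count-broken zero κ τ d r small with Broken? κ τ d []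
    ... | no _  = z≤n
    -- No positions are left, so every block is marked already and each weight is the full power of
    -- `q`.
    ... | yes b = ≤-reflexive (cong (1 *_) (prod-cong λ p → sym (cong (λ b → weight b (r p)) (dead p (b p)))))
      where
      dead : ∀ p → d p ≡ true ⊎ (∃ λ c → κ c ≡ suc p × [] c ≢ τ c) → d p ≡ true
      dead p (inj₁ e) = e
    count-broken (suc n) {P} κ τ d r small = first (κ zero) refl
      where
      Goal = count (suc n) (λ ω → ind (Broken? κ τ d ω)) * prod (λ p → q ^ r p)
               ≤ q ^ suc n * prod (λ p → weight (d p) (r p))
      block : ∀ p₀ → κ zero ≡ suc p₀ → ∀ z → r p₀ ≡ z → Goal
      first : ∀ z → κ zero ≡ z → Goal
      first (suc p₀) κ₀ = block p₀ κ₀ (r p₀) refl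
      -- Position zero lies in no block: its colour is irrelevant and contributes a factor `q` to
      -- both sides.
      first zero κ₀ = begin
        sum (λ x → count n (λ ω → ind (Broken? κ τ d (x ∷ ω)))) * R
          ≤⟨ *-monoˡ-≤ R (sum-mono (λ x → count-mono n (λ ω → ind-mono (Broken? κ τ d (x ∷ ω)) (Broken? (κ ∘ suc) (τ ∘ suc) d ω) (skip x ω)))) ⟩
        sum {q} (λ _ → c) * R    ≡⟨ cong (_* R) (sum-const q c) ⟩
        q * c * R                ≡⟨ *-assoc q c R ⟩
        q * (c * R)              ≤⟨ *-monoʳ-≤ q (count-broken n (κ ∘ suc) (τ ∘ suc) d r small′) ⟩
        q * (q ^ n * _)          ≡⟨ *-assoc q (q ^ n) _ ⟨
        q ^ suc n * _            ∎
        where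
        open ≤-Reasoning
        R = prod (λ p → q ^ r p)
        c = count n (λ ω → ind (Broken? (κ ∘ suc) (τ ∘ suc) d ω))
        skip : ∀ x ω → Broken κ τ d (x ∷ ω) → Broken (κ ∘ suc) (τ ∘ suc) d ω
        skip x ω b p with b p
        ... | inj₁ e = inj₁ e
        ... | inj₂ (zero , k , _) = contradiction (trans (sym κ₀) k) λ ()
        ... | inj₂ (suc c , k , ne) = inj₂ (c , k , ne)
        small′ : ∀ p → card (λ c → κ (suc c) ≟F suc p) ≤ r p
        small′ p = ≤-trans (m≤n+m _ _) (small p)
      -- `r p₀` bounds the size of a block that contains position zero, so it cannot be 0.
      block p₀ κ₀ zero r₀ = contradiction (≤-trans (∃⇒card-positive (λ c → κ c ≟F suc p₀) (zero , κ₀)) (≤-trans (small p₀) (≤-reflexive r₀))) λ ()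
      -- Revealing position zero changes only the mark and the remaining size of `p₀`. `R` and `V`
      -- collect the factors of the other blocks, and `sum-weight` adds up over the revealed colour.
      block p₀ κ₀ (suc k) r₀ = begin
        sum (λ x → count n (λ ω → ind (Broken? κ τ d (x ∷ ω)))) * prod (λ p → q ^ r p)
          ≤⟨ *-monoˡ-≤ _ (sum-mono (λ x → count-mono n (λ ω → ind-mono (Broken? κ τ d (x ∷ ω)) (Broken? (κ ∘ suc) (τ ∘ suc) (d′ x) ω) (reveal x ω)))) ⟩
        sum c * prod (λ p → q ^ r p)
          ≡⟨ cong (sum c *_) (trans (prod≡*rest (λ p → q ^ r p) p₀) (cong (λ z → q ^ z * R) r₀)) ⟩
        sum c * (q * q ^ k * R)
          ≡⟨ shuffle (sum c) q (q ^ k) R ⟩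
        q * (sum c * (q ^ k * R))
          ≡⟨ cong (q *_) (*-distribʳ-sum (q ^ k * R) c) ⟩
        q * sum (λ x → c x * (q ^ k * R))
          ≤⟨ *-monoʳ-≤ q (sum-mono hypothesis) ⟩
        q * sum (λ x → q ^ n * (weight (b x) k * V))
          ≡⟨ cong (q *_) (*-distribˡ-sum (q ^ n) (λ x → weight (b x) k * V)) ⟨
        q * (q ^ n * sum (λ x → weight (b x) k * V))
          ≡⟨ cong (λ z → q * (q ^ n * z)) (*-distribʳ-sum V (λ x → weight (b x) k)) ⟨
        q * (q ^ n * (sum (λ x → weight (b x) k) * V))
          ≡⟨ cong (λ z → q * (q ^ n * (z * V))) (sum-weight (d p₀) (τ zero) k) ⟩
        q * (q ^ n * (weight (d p₀) (suc k) * V))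
          ≡⟨ *-assoc q (q ^ n) _ ⟨
        q ^ suc n * (weight (d p₀) (suc k) * V)
          ≡⟨ cong (q ^ suc n *_) (trans (cong (λ z → weight (d p₀) z * V) (sym r₀)) (sym (prod≡*rest (λ p → weight (d p) (r p)) p₀))) ⟩
        q ^ suc n * prod (λ p → weight (d p) (r p)) ∎
        where
        open ≤-Reasoning
        shuffle : ∀ a b c d → a * (b * c * d) ≡ b * (a * (c * d))
        shuffle = solve-∀
        b : Fin q → Bool
        b x = mark (d p₀) (x ≟F τ zero)
        d′ : Fin q → Fin P → Bool
        d′ x = updateAt d p₀ (const (b x))
        r′ : Fin P → ℕ
        r′ = updateAt r p₀ (const k)
        d′₀ : ∀ x → d′ x p₀ ≡ b x
        d′₀ x = updateAt-updates p₀ d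
        r′₀ : r′ p₀ ≡ k
        r′₀ = updateAt-updates p₀ r
        d′≢ : ∀ x p → p ≢ p₀ → d′ x p ≡ d p
        d′≢ x p ne = updateAt-minimal p p₀ d ne
        r′≢ : ∀ p → p ≢ p₀ → r′ p ≡ r p
        r′≢ p ne = updateAt-minimal p p₀ r ne
        c : Fin q → ℕ
        c x = count n (λ ω → ind (Broken? (κ ∘ suc) (τ ∘ suc) (d′ x) ω))
        R = rest (λ p → q ^ r p) p₀
        V = rest (λ p → weight (d p) (r p)) p₀
        reveal : ∀ x ω → Broken κ τ d (x ∷ ω) → Broken (κ ∘ suc) (τ ∘ suc) (d′ x) ω
        reveal x ω br p with p ≟F p₀ | br p
        ... | yes refl | inj₁ e = inj₁ (trans (d′₀ x) (trans (cong (λ z → mark z (x ≟F τ zero)) e) (mark-true (x ≟F τ zero))))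
        ... | yes refl | inj₂ (zero , _ , ne) = inj₁ (trans (d′₀ x) (mark-no (x ≟F τ zero) (d p₀) ne))
        ... | no ne | inj₁ e = inj₁ (trans (d′≢ x p ne) e)
        ... | no ne | inj₂ (zero , e , _) = contradiction (suc-injective (trans (sym e) κ₀)) ne
        ... | _ | inj₂ (suc c , e , ne) = inj₂ (c , e , ne)
        small′ : ∀ p → card (λ c → κ (suc c) ≟F suc p) ≤ r′ p
        small′ p with p ≟F p₀
        ... | yes refl = ≤-trans (s≤s⁻¹ (≤-trans (+-monoˡ-≤ _ (≤-reflexive (sym (ind-yes (κ zero ≟F suc p) κ₀)))) (≤-trans (small p) (≤-reflexive r₀))))
                                 (≤-reflexive (sym r′₀))
        ... | no ne = ≤-trans (m≤n+m _ _) (≤-trans (small p) (≤-reflexive (sym (r′≢ p ne))))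
        hypothesis : ∀ x → c x * (q ^ k * R) ≤ q ^ n * (weight (b x) k * V)
        hypothesis x = begin
          c x * (q ^ k * R)
            ≡⟨ cong (c x *_) (trans (prod≡*rest (λ p → q ^ r′ p) p₀)
                              (cong₂ _*_ (cong (q ^_) r′₀) (rest-cong _ _ p₀ (λ p ne → cong (q ^_) (r′≢ p ne))))) ⟨
          c x * prod (λ p → q ^ r′ p)
            ≤⟨ count-broken n (κ ∘ suc) (τ ∘ suc) (d′ x) r′ small′ ⟩
          q ^ n * prod (λ p → weight (d′ x p) (r′ p))
            ≡⟨ cong (q ^ n *_) (trans (prod≡*rest (λ p → weight (d′ x p) (r′ p)) p₀)
                              (cong₂ _*_ (cong₂ weight (d′₀ x) r′₀) (rest-cong _ _ p₀ (λ p ne → cong₂ weight (d′≢ x p ne) (r′≢ p ne))))) ⟩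
          q ^ n * (weight (b x) k * V) ∎

  -- Pseudorandom colourings of a product

  pair : ∀ {m} → Fin (suc m) → Fin (suc m) → Fin (suc (m * m))
  pair zero    _       = zero
  pair (suc i) zero    = zero
  pair (suc i) (suc j) = suc (combine i j)

  pair⁻¹ : ∀ {m} (x y : Fin (suc m)) i j → pair x y ≡ suc (combine i j) → x ≡ suc i × y ≡ suc j
  pair⁻¹ (suc x) (suc y) i j eq with combine-injective x y i j (suc-injective eq)
  ... | refl , refl = refl , refl

  module _ (q-1 m α β kA kB : ℕ) where

    open Colourings q-1

    private
      -- In a random colouring, a rectangle of at most `kA * kB` cells has its target colours
      -- everywhere with probability at least `1 / Q`.
      Q : ℕ
      Q = q ^ (kA * kB)

    -- A map into `Fin (suc m)` encodes `m` disjoint sets, with value zero on the elements outside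
    -- all of them; there are `suc m ^ n` such maps.
    Small : ∀ {n} → ℕ → (Fin n → Fin (suc m)) → Set
    Small k φ = ∀ i → card (λ a → φ a ≟F suc i) ≤ k

    Small? : ∀ {n} k φ → Dec (Small {n} k φ)
    Small? k φ = all? (λ i → card (λ a → φ a ≟F suc i) ≤? k)

    -- A decoded function agrees with the encoded one only pointwise, so properties are transported
    -- along pointwise equality; `Hit-resp` serves the same end.
    Small-resp : ∀ {n} k {φ φ′ : Fin n → Fin (suc m)} → (∀ a → φ a ≡ φ′ a) → Small k φ → Small k φ′
    Small-resp k {φ} {φ′} eq small i =
      ≤-trans (sum-mono (λ a → ind-mono (φ′ a ≟F suc i) (φ a ≟F suc i) (trans (eq a)))) (small i)

    -- Disjoint sets of rows and of columns span `m * m` disjoint rectangles. These are the blocks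
    -- for `count-broken`, and disjointness makes them independent.
    grid : (Fin α → Fin (suc m)) → (Fin β → Fin (suc m)) → Fin (α * β) → Fin (suc (m * m))
    grid φ ψ c = pair (φ (quotient β c)) (ψ (remainder {α} β c))

    grid-combine : ∀ φ ψ a b → grid φ ψ (combine {α} {β} a b) ≡ pair (φ a) (ψ b)
    grid-combine φ ψ a b = cong (λ ab → pair (φ (proj₁ ab)) (ψ (proj₂ ab))) (remQuot-combine {α} {β} a b)

    grid-small : ∀ φ ψ → Small kA φ → Small kB ψ → ∀ p → card (λ c → grid φ ψ c ≟F suc p) ≤ kA * kB
    grid-small φ ψ smallφ smallψ p with combine-surjective {m} {m} p
    ... | i , j , refl = begin
      card (λ c → grid φ ψ c ≟F suc (combine i j))
        ≡⟨ sum-combine {α} {β} (λ c → ind (grid φ ψ c ≟F suc (combine i j))) ⟩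
      sum (λ a → sum (λ b → ind (grid φ ψ (combine {α} {β} a b) ≟F suc (combine i j))))
        ≤⟨ sum-mono (λ a → sum-mono (λ b → cell a b)) ⟩
      sum (λ a → sum (λ b → ind (φ a ≟F suc i) * ind (ψ b ≟F suc j)))
        ≡⟨ sum-cong-≗ {α} (λ a → *-distribˡ-sum {β} (ind (φ a ≟F suc i)) (λ b → ind (ψ b ≟F suc j))) ⟨
      sum (λ a → ind (φ a ≟F suc i) * card (λ b → ψ b ≟F suc j))
        ≡⟨ *-distribʳ-sum (card (λ b → ψ b ≟F suc j)) (λ a → ind (φ a ≟F suc i)) ⟨
      card (λ a → φ a ≟F suc i) * card (λ b → ψ b ≟F suc j)
        ≤⟨ *-mono-≤ (smallφ i) (smallψ j) ⟩
      kA * kB ∎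
      where
      open ≤-Reasoning
      cell : ∀ a b → ind (grid φ ψ (combine {α} {β} a b) ≟F suc (combine i j)) ≤ ind (φ a ≟F suc i) * ind (ψ b ≟F suc j)
      cell a b = ≤-trans (ind-mono (grid φ ψ (combine {α} {β} a b) ≟F suc (combine i j)) (φ a ≟F suc i ×-dec ψ b ≟F suc j)
                                   (λ eq → pair⁻¹ (φ a) (ψ b) i j (trans (sym (grid-combine φ ψ a b)) eq)))
                         (≤-reflexive (ind-× (φ a ≟F suc i) (ψ b ≟F suc j)))

    -- When `a` and `b` are non-adjacent exactly if `ω a b ≡ ρ b`, this says that every set of `φ`
    -- sends an edge to every set of `ψ`.
    Hit : (Fin α → Fin (suc m)) → (Fin β → Fin (suc m)) → (Fin β → Fin q) → (Fin α → Fin β → Fin q) → Set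
    Hit φ ψ ρ ω = ∀ i j → ∃₂ λ a b → φ a ≡ suc i × ψ b ≡ suc j × ω a b ≢ ρ b

    Hit-resp : ∀ {φ φ′ ψ ψ′ ρ ρ′ ω} → (∀ a → φ a ≡ φ′ a) → (∀ b → ψ b ≡ ψ′ b) → (∀ b → ρ b ≡ ρ′ b) →
               Hit φ ψ ρ ω → Hit φ′ ψ′ ρ′ ω
    Hit-resp φ≗ ψ≗ ρ≗ hit i j with hit i j
    ... | a , b , φa , ψb , ne =
      a , b , trans (sym (φ≗ a)) φa , trans (sym (ψ≗ b)) ψb , λ eq → ne (trans eq (sym (ρ≗ b)))

    target : (Fin β → Fin q) → Fin (α * β) → Fin q
    target ρ c = ρ (remainder {α} β c)

    hit⇒broken : ∀ φ ψ ρ ω → Hit φ ψ ρ (λ a b → ω (combine a b)) →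
                 Broken (grid φ ψ) (target ρ) (λ _ → false) ω
    hit⇒broken φ ψ ρ ω hit p with combine-surjective {m} {m} p
    ... | i , j , refl with hit i j
    ...   | a , b , φa , ψb , ne = inj₂ (combine {α} {β} a b
            , trans (grid-combine φ ψ a b) (cong₂ pair φa ψb)
            , λ eq → ne (trans eq (cong (λ ab → ρ (proj₂ ab)) (remQuot-combine {α} {β} a b))))

    -- All targets `ρ` are covered because the rare colours are read off from `ω` only after it has
    -- been fixed.
    Pseudorandom : (Fin α → Fin β → Fin q) → Set
    Pseudorandom ω = ∀ φ ψ (ρ : Fin β → Fin q) → Small kA φ → Small kB ψ →
                     ¬ Hit φ ψ ρ ω

    -- Divided by `Q ^ (m * m)`, the hypothesis says that the number of triples of `φ`, `ψ` and `ρ`,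
    -- times the probability bound for a single triple, is below 1.
    pseudorandom-exists : suc m ^ α * (suc m ^ β * q ^ β) * (Q ∸ 1) ^ (m * m) < Q ^ (m * m) →
                          ∃ Pseudorandom
    pseudorandom-exists few = (λ a b → ω (combine {α} {β} a b)) , pseudorandom
      where
      E₂ = suc m ^ β * q ^ β
      E = suc m ^ α * E₂

      φ̂ : Fin E → Fin α → Fin (suc m)
      φ̂ e = finToFun (quotient E₂ e)
      ψ̂ : Fin E → Fin β → Fin (suc m)
      ψ̂ e = finToFun (quotient (q ^ β) (remainder {suc m ^ α} E₂ e))
      ρ̂ : Fin E → Fin β → Fin q
      ρ̂ e = finToFun (remainder {suc m ^ β} (q ^ β) (remainder {suc m ^ α} E₂ e))

      Bad : (Fin α → Fin (suc m)) → (Fin β → Fin (suc m)) → (Fin β → Fin q) → (Fin (α * β) → Fin q) → Set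
      Bad φ ψ ρ ω = (Small kA φ × Small kB ψ) × Broken (grid φ ψ) (target ρ) (λ _ → false) ω

      Bad? : ∀ φ ψ ρ ω → Dec (Bad φ ψ ρ ω)
      Bad? φ ψ ρ ω = (Small? kA φ ×-dec Small? kB ψ) ×-dec Broken? (grid φ ψ) (target ρ) (λ _ → false) ω

      count-bad : ∀ φ ψ ρ → count (α * β) (λ ω → ind (Bad? φ ψ ρ ω)) * Q ^ (m * m) ≤ q ^ (α * β) * (Q ∸ 1) ^ (m * m)
      count-bad φ ψ ρ = by (Small? kA φ ×-dec Small? kB ψ)
        where
        open ≤-Reasoning
        by : Dec (Small kA φ × Small kB ψ) → count (α * β) (λ ω → ind (Bad? φ ψ ρ ω)) * Q ^ (m * m) ≤ q ^ (α * β) * (Q ∸ 1) ^ (m * m)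
        by (yes (smallφ , smallψ)) = begin
          count (α * β) (λ ω → ind (Bad? φ ψ ρ ω)) * Q ^ (m * m)
            ≤⟨ *-monoˡ-≤ _ (count-mono (α * β) (λ ω → ind-mono (Bad? φ ψ ρ ω) (Broken? (grid φ ψ) (target ρ) (λ _ → false) ω) proj₂)) ⟩
          count (α * β) (λ ω → ind (Broken? (grid φ ψ) (target ρ) (λ _ → false) ω)) * Q ^ (m * m)
            ≡⟨ cong (count (α * β) (λ ω → ind (Broken? (grid φ ψ) (target ρ) (λ _ → false) ω)) *_) (prod-const (m * m) Q) ⟨
          count (α * β) (λ ω → ind (Broken? (grid φ ψ) (target ρ) (λ _ → false) ω)) * _
            ≤⟨ count-broken (α * β) (grid φ ψ) (target ρ) (λ _ → false) (λ _ → kA * kB) (grid-small φ ψ smallφ smallψ) ⟩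
          q ^ (α * β) * _
            ≡⟨ cong (q ^ (α * β) *_) (prod-const (m * m) (Q ∸ 1)) ⟩
          q ^ (α * β) * (Q ∸ 1) ^ (m * m) ∎
        -- Families with a large set are bad for no colouring, which lets the union range over all
        -- codes.
        by (no ¬small) = begin
          count (α * β) (λ ω → ind (Bad? φ ψ ρ ω)) * Q ^ (m * m)
            ≤⟨ *-monoˡ-≤ _ (count-mono (α * β) (λ ω → ≤-reflexive (ind-no (Bad? φ ψ ρ ω) (¬small ∘ proj₁)))) ⟩
          count (α * β) (λ _ → 0) * Q ^ (m * m)
            ≡⟨ cong (_* Q ^ (m * m)) (count-zero (α * β)) ⟩
          0
            ≤⟨ z≤n ⟩
          q ^ (α * β) * (Q ∸ 1) ^ (m * m) ∎

      good : ∃ λ ω → ∀ e → ind (Bad? (φ̂ e) (ψ̂ e) (ρ̂ e) ω) ≡ 0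
      good = union-bound (α * β) (λ e ω → ind (Bad? (φ̂ e) (ψ̂ e) (ρ̂ e) ω)) ((Q ∸ 1) ^ (m * m)) (Q ^ (m * m))
                         (λ e → count-bad (φ̂ e) (ψ̂ e) (ρ̂ e)) few

      ω : Fin (α * β) → Fin q
      ω = proj₁ good

      pseudorandom : Pseudorandom (λ a b → ω (combine {α} {β} a b))
      pseudorandom φ ψ ρ smallφ smallψ hit =
        contradiction (trans (sym (ind-yes (Bad? (φ̂ e) (ψ̂ e) (ρ̂ e) ω) bad)) (proj₂ good e)) λ ()
        where
        e₂ : Fin E₂
        e₂ = combine (funToFin ψ) (funToFin ρ)
        e : Fin E
        e = combine (funToFin φ) e₂
        φ≗ : ∀ a → φ a ≡ φ̂ e a
        φ≗ a = sym (trans (cong (λ z → finToFun (proj₁ z) a) (remQuot-combine (funToFin φ) e₂)) (finToFun-funToFin φ a))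
        rem-e : remainder {suc m ^ α} E₂ e ≡ e₂
        rem-e = cong proj₂ (remQuot-combine (funToFin φ) e₂)
        ψ≗ : ∀ b → ψ b ≡ ψ̂ e b
        ψ≗ b = sym (trans (cong (λ z → finToFun (quotient (q ^ β) z) b) rem-e)
                   (trans (cong (λ z → finToFun (proj₁ z) b) (remQuot-combine (funToFin ψ) (funToFin ρ))) (finToFun-funToFin ψ b)))
        ρ≗ : ∀ b → ρ b ≡ ρ̂ e b
        ρ≗ b = sym (trans (cong (λ z → finToFun (remainder {suc m ^ β} (q ^ β) z) b) rem-e)
                   (trans (cong (λ z → finToFun (proj₂ z) b) (remQuot-combine (funToFin ψ) (funToFin ρ))) (finToFun-funToFin ρ b)))
        bad : Bad (φ̂ e) (ψ̂ e) (ρ̂ e) ω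
        bad = (Small-resp kA φ≗ smallφ , Small-resp kB ψ≗ smallψ) , hit⇒broken (φ̂ e) (ψ̂ e) (ρ̂ e) ω (Hit-resp φ≗ ψ≗ ρ≗ hit)

  -- The glued graph

  length-filter-tabulate : ∀ {n} {A : Set} {P : A → Set} (P? : ∀ x → Dec (P x)) (f : Fin n → A) →
                           length (filter P? (tabulate f)) ≡ card (λ i → P? (f i))
  length-filter-tabulate {zero}  P? f = refl
  length-filter-tabulate {suc n} P? f with P? (f zero)
  ... | yes _ = cong suc (length-filter-tabulate P? (f ∘ suc))
  ... | no _  = length-filter-tabulate P? (f ∘ suc)

  palette : ∀ {p} {P : Fin p → Set} → (∀ y → Dec (P y)) → List ℕ
  palette {p} P? = map toℕ (filter P? (allFin p))

  palette-unique : ∀ {p} {P : Fin p → Set} (P? : ∀ y → Dec (P y)) → Unique (palette P?)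
  palette-unique {p} P? = Unique.map⁺ toℕ-injective (Unique.filter⁺ P? (Unique.allFin⁺ p))

  length-palette : ∀ {p} {P : Fin p → Set} (P? : ∀ y → Dec (P y)) → length (palette P?) ≡ card P?
  length-palette {p} P? = trans (length-map toℕ (filter P? (allFin p))) (length-filter-tabulate P? (λ i → i))

  palette-∈ : ∀ {p} {P : Fin p → Set} (P? : ∀ y → Dec (P y)) {c} → c ∈ palette P? → ∃ λ y → P y × c ≡ toℕ y
  palette-∈ {p} P? c∈ with ∈-map⁻ toℕ c∈
  ... | y , y∈ , eq = y , proj₂ (∈-filter⁻ P? {xs = allFin p} y∈) , eq

  -- One copy of the clique on Fin β for every colouring of the clique on Fin α with p colours,
  -- all glued along the latter; R lists the non-adjacent pairs between the two cliques.
  module Gluing (α β p : ℕ) {R : Fin α → Fin β → Set} (R? : ∀ a b → Dec (R a b)) where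

    -- A vertex of the first clique, or a vertex of the second together with its copy, whose index
    -- encodes a colouring via `finToFun`. `Vertex` flattens this to the `Fin` that `Graph` asks
    -- for.
    View : Set
    View = Fin α ⊎ (Fin (p ^ α) × Fin β)

    Vertex : Set
    Vertex = Fin (α + p ^ α * β)

    view : Vertex → View
    view v = [ inj₁ , (λ w → inj₂ (remQuot {p ^ α} β w)) ]′ (splitAt α v)

    vertex : View → Vertex
    vertex (inj₁ a)       = a ↑ˡ (p ^ α * β)
    vertex (inj₂ (i , b)) = α ↑ʳ combine i b

    view-vertex : ∀ w → view (vertex w) ≡ w
    view-vertex (inj₁ a) rewrite splitAt-↑ˡ α a (p ^ α * β) = refl
    view-vertex (inj₂ (i , b)) rewrite splitAt-↑ʳ α (p ^ α * β) (combine i b) =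
      cong inj₂ (remQuot-combine i b)

    vertex-view : ∀ v → vertex (view v) ≡ v
    vertex-view v = trans (by (splitAt α v)) (join-splitAt α (p ^ α * β) v)
      where
      by : ∀ w → vertex ([ inj₁ , (λ w → inj₂ (remQuot {p ^ α} β w)) ]′ w) ≡ join α (p ^ α * β) w
      by (inj₁ a) = refl
      by (inj₂ w) = cong (α ↑ʳ_) (combine-remQuot {p ^ α} β w)

    Edge : View → View → Set
    Edge (inj₁ a)       (inj₁ a′)       = a ≢ a′
    Edge (inj₁ a)       (inj₂ (_ , b))  = ¬ R a b
    Edge (inj₂ (_ , b)) (inj₁ a)        = ¬ R a b
    Edge (inj₂ (i , b)) (inj₂ (j , b′)) = i ≡ j × b ≢ b′

    Edge-sym : ∀ u v → Edge u v → Edge v u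
    Edge-sym (inj₁ _) (inj₁ _) ne       = ne ∘ sym
    Edge-sym (inj₁ _) (inj₂ _) ¬r       = ¬r
    Edge-sym (inj₂ _) (inj₁ _) ¬r       = ¬r
    Edge-sym (inj₂ _) (inj₂ _) (e , ne) = sym e , ne ∘ sym

    Edge-irrefl : ∀ v → ¬ Edge v v
    Edge-irrefl (inj₁ _) ne       = ne refl
    Edge-irrefl (inj₂ _) (_ , ne) = ne refl

    glued : Graph
    glued = record
      { n      = α + p ^ α * β
      ; Adj    = λ u v → Edge (view u) (view v)
      ; sym    = λ {u} {v} → Edge-sym (view u) (view v)
      ; irrefl = λ {v} → Edge-irrefl (view v)
      }

    Forbidden : Fin (p ^ α) → Fin β → Fin p → Set
    Forbidden i b y = ∃ λ a → R a b × finToFun i a ≡ y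

    Forbidden? : ∀ i b y → Dec (Forbidden i b y)
    Forbidden? i b y = any? λ a → R? a b ×-dec (finToFun i a ≟F y)

    Allowed : View → Fin p → Set
    Allowed (inj₁ a)       y = ⊤
    Allowed (inj₂ (i , b)) y = ¬ Forbidden i b y

    Allowed? : ∀ w y → Dec (Allowed w y)
    Allowed? (inj₁ a)       y = yes tt
    Allowed? (inj₂ (i , b)) y = ¬? (Forbidden? i b y)

    -- Each non-neighbour of `b` forbids at most one colour, its own under the colouring encoded by
    -- `i`.
    card-Forbidden : ∀ i b → card (Forbidden? i b) ≤ card (λ a → R? a b)
    card-Forbidden i b = begin
      sum (λ y → ind (Forbidden? i b y))
        ≤⟨ sum-mono (λ y → ind-any≤card (λ a → R? a b ×-dec (finToFun i a ≟F y))) ⟩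
      sum (λ y → sum (λ a → ind (R? a b ×-dec (finToFun i a ≟F y))))
        ≡⟨ ∑-comm (λ y a → ind (R? a b ×-dec (finToFun i a ≟F y))) ⟩
      sum (λ a → sum (λ y → ind (R? a b ×-dec (finToFun i a ≟F y))))
        ≡⟨ sum-cong-≗ {α} (λ a → sum-cong-≗ {p} (λ y → ind-× (R? a b) (finToFun i a ≟F y))) ⟩
      sum (λ a → sum (λ y → ind (R? a b) * ind (finToFun i a ≟F y)))
        ≡⟨ sum-cong-≗ {α} (λ a → *-distribˡ-sum {p} (ind (R? a b)) (λ y → ind (finToFun i a ≟F y))) ⟨
      sum (λ a → ind (R? a b) * card (λ y → finToFun i a ≟F y))
        ≤⟨ sum-mono (λ a → *-monoʳ-≤ (ind (R? a b)) (sum-ind-unique (λ y → finToFun i a ≟F y) (λ _ _ e e′ → trans (sym e) e′))) ⟩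
      sum (λ a → ind (R? a b) * 1)
        ≡⟨ sum-cong-≗ {α} (λ a → *-identityʳ (ind (R? a b))) ⟩
      card (λ a → R? a b) ∎
      where open ≤-Reasoning

    -- On the copy indexed by the colouring of the first clique all colours would be distinct.
    no-list-colouring : p < α + β → (y : View → Fin p) → (∀ w → Allowed w (y w)) →
                        ¬ (∀ u v → Edge u v → y u ≢ y v)
    no-list-colouring p<α+β y allowed distinct = clash (pigeonhole p<α+β (h ∘ splitAt α))
      where
      x : Fin α → Fin p
      x a = y (inj₁ a)

      i₀ : Fin (p ^ α)
      i₀ = funToFin x

      place : Fin α ⊎ Fin β → View
      place (inj₁ a) = inj₁ a
      place (inj₂ b) = inj₂ (i₀ , b)

      h : Fin α ⊎ Fin β → Fin p
      h w = y (place w)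

      across : ∀ a b → h (inj₁ a) ≢ h (inj₂ b)
      -- Non-adjacent pairs differ because the list of `b` in this copy lacks the colour of `a`,
      -- adjacent pairs because the colouring is proper.
      across a b eq with R? a b
      ... | yes r = allowed (inj₂ (i₀ , b)) (a , r , trans (finToFun-funToFin x a) eq)
      ... | no ¬r = distinct (inj₁ a) (inj₂ (i₀ , b)) ¬r eq

      h-injective : ∀ u v → h u ≡ h v → u ≡ v
      h-injective (inj₁ a) (inj₁ a′) eq with a ≟F a′
      ... | yes refl = refl
      ... | no ne    = contradiction eq (distinct (inj₁ a) (inj₁ a′) ne)
      h-injective (inj₁ a) (inj₂ b)  eq = contradiction eq (across a b)
      h-injective (inj₂ b) (inj₁ a)  eq = contradiction (sym eq) (across a b)
      h-injective (inj₂ b) (inj₂ b′) eq with b ≟F b′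
      ... | yes refl = refl
      ... | no ne    = contradiction eq (distinct (inj₂ (i₀ , b)) (inj₂ (i₀ , b′)) (refl , ne))

      clash : ¬ (∃₂ λ i j → i Data.Fin.< j × h (splitAt α i) ≡ h (splitAt α j))
      clash (i , j , i<j , eq) = <⇒≢ i<j (cong toℕ
        (trans (sym (join-splitAt α β i)) (trans (cong (join α β) (h-injective _ _ eq)) (join-splitAt α β j))))

    module _ {k δ} (degree : ∀ b → card (λ a → R? a b) ≤ δ) (k+δ≤p : k + δ ≤ p) where

      lists-long : ∀ w → k ≤ length (palette (Allowed? w))
      lists-long w = subst (k ≤_) (sym (length-palette (Allowed? w))) (by w)
        where
        by : ∀ w → k ≤ card (Allowed? w)
        by (inj₁ a)       = ≤-trans (≤-trans (m≤m+n k δ) k+δ≤p) (≤-reflexive (sym (sum-ones p)))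
        by (inj₂ (i , b)) = +-cancelʳ-≤ δ k _ (≤-trans k+δ≤p (≤-trans (card-complement (Forbidden? i b))
                              (+-monoʳ-≤ _ (≤-trans (card-Forbidden i b) (degree b)))))

      glued-not-choosable : p < α + β → ¬ Choosable glued k
      glued-not-choosable p<α+β choosable
        with choosable (λ v → palette (Allowed? (view v))) (λ v → palette-unique (Allowed? (view v))) (λ v → lists-long (view v))
      ... | c , c∈ , proper =
        no-list-colouring p<α+β (λ w → proj₁ (colour w)) (λ w → proj₁ (proj₂ (colour w))) distinct
        where
        colour : ∀ w → ∃ λ y → Allowed w y × c (vertex w) ≡ toℕ y
        colour w = palette-∈ (Allowed? w) (subst (λ z → c (vertex w) ∈ palette (Allowed? z)) (view-vertex w) (c∈ (vertex w)))

        distinct : ∀ u v → Edge u v → proj₁ (colour u) ≢ proj₁ (colour v)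
        distinct u v e eq = proper (vertex u) (vertex v)
          (subst₂ Edge (sym (view-vertex u)) (sym (view-vertex v)) e)
          (trans (proj₂ (proj₂ (colour u))) (trans (cong toℕ eq) (sym (proj₂ (proj₂ (colour v))))))

  -- Excluding the minor

  -- Branch sets are arbitrary predicates. Since the goal is a contradiction, this finite
  -- double-negation shift lets membership be treated as decidable.
  ¬¬-∀ : ∀ {n} {P : Fin n → Set} → (∀ i → ¬ ¬ P i) → ¬ ¬ (∀ i → P i)
  ¬¬-∀ {zero}  nn k = k λ ()
  ¬¬-∀ {suc n} nn k = nn zero λ p → ¬¬-∀ (nn ∘ suc) λ ps → k λ { zero → p ; (suc i) → ps i }

  module _ {m n} {W : Fin m → Fin n → Set} (W? : ∀ i x → Dec (W i x)) where

    -- Recodes a family of disjoint sets as a labelling map, the form in which `Pseudorandom` takes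
    -- its families.
    locate : Fin n → Fin (suc m)
    locate x with any? (λ i → W? i x)
    ... | yes (i , _) = suc i
    ... | no _        = zero

    locate-sound : ∀ x i → locate x ≡ suc i → W i x
    locate-sound x i eq with any? (λ i → W? i x)
    locate-sound x i refl | yes (_ , w) = w

    locate-complete : (∀ i j x → W i x → W j x → i ≡ j) → ∀ x i → W i x → locate x ≡ suc i
    locate-complete unique x i w with any? (λ i → W? i x)
    ... | yes (j , w′) = cong suc (unique j i x w′ w)
    ... | no none      = contradiction (i , w) none

  agree? : ∀ {α β q} (ω : Fin α → Fin β → Fin q) (ρ : Fin β → Fin q) → ∀ a b → Dec (ω a b ≡ ρ b)
  agree? ω ρ a b = ω a b ≟F ρ b

  -- By `s-big` and `t-big` each side has at least `m + m` branch sets avoiding the first clique; by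
  -- `s+t-big` at least four times `m` branch sets miss any given copy of the second. `α-small` and
  -- `β-small` leave at most `m` sets with more than `kA` vertices in the first clique, or more than
  -- `kB` in one copy.
  module MinorFree
    (q-1 m α β kA kB p s t : ℕ)
    (ω : Fin α → Fin β → Fin (suc q-1)) (ρ : Fin β → Fin (suc q-1))
    (pseudorandom : Pseudorandom q-1 m α β kA kB ω)
    (m>0 : 1 ≤ m)
    (s-big : α + (m + m) ≤ s) (t-big : α + (m + m) ≤ t) (s+t-big : β + ((m + m) + (m + m)) ≤ s + t)
    (α-small : α ≤ m * suc kA) (β-small : β ≤ m * suc kB)
    where

    open Gluing α β p (agree? ω ρ)

    vA : Fin α → Vertex
    vA a = vertex (inj₁ a)

    vB : Fin (p ^ α) → Fin β → Vertex
    vB i b = vertex (inj₂ (i , b))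

    module _ (model : HasMinor glued (K s t)) where

      open MinorModel model

      InCopy : Fin (p ^ α) → Vertex → Set
      InCopy i v = ∃ λ b → view v ≡ inj₂ (i , b)

      AvoidsA : Fin (s + t) → Set
      AvoidsA f = ∀ a → ¬ Z f (vA a)

      to-vertex : ∀ {f v w} → view v ≡ w → Z f v → Z f (vertex w)
      to-vertex {f} {v} eq z = subst (Z f) (trans (sym (vertex-view v)) (cong vertex eq)) z

      avoidsA-view : ∀ {f} → AvoidsA f → ∀ {v} → Z f v → ∃ λ i → InCopy i v
      avoidsA-view {f} av {v} z with view v in eq
      ... | inj₁ a = contradiction (to-vertex eq z) (av a)
      ... | inj₂ (i , b) = i , b , refl

      edge-copy : ∀ {i j u v} → InCopy i u → InCopy j v → Edge (view u) (view v) → i ≡ j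
      edge-copy (b , eq) (b′ , eq′) e = proj₁ (subst₂ Edge eq eq′ e)

      -- Different copies are joined only through the first clique, so a walk that avoids it stays
      -- in its copy.
      walk-copy : ∀ {f} → AvoidsA f → ∀ {i u v} → InCopy i u → WalkIn glued (Z f) u v → InCopy i v
      walk-copy av u∈ (here _) = u∈
      walk-copy {f} av {i} {u} u∈ (step {w = w} zu e walk) = walk-copy av w∈ walk
        where
        next : ∀ {x} → WalkIn glued (Z f) w x → Z f w
        next (here z)     = z
        next (step z _ _) = z
        w∈ : InCopy i w
        w∈ with avoidsA-view av (next walk)
        ... | j , w∈j = subst (λ j → InCopy j w) (sym (edge-copy {u = u} {v = w} u∈ w∈j e)) w∈j

      -- The edge between the two branch sets puts a vertex of `g` into the copy of `f`;
      -- connectedness brings the rest of `g` there.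
      neighbour-copy : ∀ {i f g} → AvoidsA f → AvoidsA g → Adj (K s t) f g →
                       (∀ {u} → Z f u → InCopy i u) → ∀ {v} → Z g v → InCopy i v
      neighbour-copy {i} {f} {g} avf avg adj f∈ {v} z with edges f g adj
      ... | u , w , zu , zw , e with avoidsA-view avg zw
      ...   | j , w∈ = walk-copy avg (subst (λ j → InCopy j w) (sym (edge-copy {u = u} {v = w} (f∈ zu) w∈ e)) w∈) (connected g w v zw z)

      left : Fin s → Fin (s + t)
      left i = i ↑ˡ t

      right : Fin t → Fin (s + t)
      right j = s ↑ʳ j

      left-right : ∀ i j → Adj (K s t) (left i) (right j)
      left-right i j = inj₁ (subst (_< s) (sym (toℕ-↑ˡ i t)) (toℕ<n i) , subst (s ≤_) (sym (toℕ-↑ʳ s j)) (m≤m+n s _))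

      module _ (Z? : ∀ f v → Dec (Z f v)) where

        -- Stated once for an arbitrary list `g` of branch sets, and used for the left side, the
        -- right side and all of them together.
        module Side {ℓ} (g : Fin ℓ → Fin (s + t)) (g-injective : ∀ i j → g i ≡ g j → i ≡ j) where

          ZA? : ∀ i a → Dec (Z (g i) (vA a))
          ZA? i a = Z? (g i) (vA a)

          ZB? : ∀ c i b → Dec (Z (g i) (vB c b))
          ZB? c i b = Z? (g i) (vB c b)

          same : ∀ i j v → Z (g i) v → Z (g j) v → i ≡ j
          same i j v z z′ = g-injective i j (disjoint (g i) (g j) v z z′)

          module A = Family ZA?
          module B c = Family (ZB? c)

          MeetsA? : ∀ i → Dec (1 ≤ A.size i)
          MeetsA? i = 1 ≤? A.size i

          MeetsB? : ∀ c i → Dec (1 ≤ B.size c i)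
          MeetsB? c i = 1 ≤? B.size c i

          sum-sizeA≤ : sum A.size ≤ α
          sum-sizeA≤ = A.sum-size≤ (λ i j a → same i j (vA a))

          sum-sizeB≤ : ∀ c → sum (B.size c) ≤ β
          sum-sizeB≤ c = B.sum-size≤ c (λ i j b → same i j (vB c b))

          card-MeetsA≤ : card MeetsA? ≤ α
          card-MeetsA≤ = ≤-trans (≤-trans (≤-reflexive (sym (*-identityʳ _))) (A.large*h≤ 1)) sum-sizeA≤

          ¬MeetsA⇒AvoidsA : ∀ {i} → ¬ (1 ≤ A.size i) → AvoidsA (g i)
          ¬MeetsA⇒AvoidsA {i} none a z = none (∃⇒card-positive (ZA? i) (a , z))

          many-AvoidsA : ∀ {r} → α + r ≤ ℓ → r ≤ card (λ i → ¬? (MeetsA? i))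
          many-AvoidsA {r} le = +-cancelˡ-≤ α _ _
            (≤-trans le (≤-trans (card-complement MeetsA?) (≤-trans (+-monoʳ-≤ _ card-MeetsA≤) (≤-reflexive (+-comm _ α)))))

          ∃-AvoidsA : α + (m + m) ≤ ℓ → ∃ λ i → AvoidsA (g i)
          ∃-AvoidsA le with card-positive⇒∃ (λ i → ¬? (MeetsA? i)) (≤-trans (≤-trans m>0 (m≤m+n m m)) (many-AvoidsA le))
          ... | i , none = i , ¬MeetsA⇒AvoidsA none

        -- The sides play different roles: the chosen sets of side `g` miss copy `c`, those of side
        -- `h` avoid the first clique and hence lie in copy `c`. Edges between them run from the
        -- first clique to copy `c`, where `ω` decides adjacency.
        module Clash {ℓ₁ ℓ₂}
          (g : Fin ℓ₁ → Fin (s + t)) (g-injective : ∀ i j → g i ≡ g j → i ≡ j)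
          (h : Fin ℓ₂ → Fin (s + t)) (h-injective : ∀ i j → h i ≡ h j → i ≡ j)
          (adjacent : ∀ i j → Adj (K s t) (g i) (h j))
          (c : Fin (p ^ α)) (one-copy : ∀ {f} → AvoidsA f → ∀ {v} → Z f v → InCopy c v)
          where

          module G = Side g g-injective
          module H = Side h h-injective

          drop-large : ∀ {n} {P Q : Fin n → Set} (P? : ∀ i → Dec (P i)) (Q? : ∀ i → Dec (Q i)) →
                       m + m ≤ card P? → card Q? ≤ m → m ≤ card (λ i → P? i ×-dec ¬? (Q? i))
          drop-large P? Q? many few = +-cancelʳ-≤ m m _ (≤-trans many (≤-trans (card-diff P? Q?) (+-monoʳ-≤ _ few)))

          module _
            (ι : Fin m → Fin ℓ₁) (ι-injective : ∀ i j → ι i ≡ ι j → i ≡ j)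
            (κ : Fin m → Fin ℓ₂) (κ-injective : ∀ i j → κ i ≡ κ j → i ≡ j)
            (ι-avoidsB : ∀ i b → ¬ Z (g (ι i)) (vB c b)) (ι-small : ∀ i → G.A.size (ι i) ≤ kA)
            (κ-avoidsA : ∀ j → AvoidsA (h (κ j))) (κ-small : ∀ j → H.B.size c (κ j) ≤ kB)
            where

            WA? : ∀ i a → Dec (Z (g (ι i)) (vA a))
            WA? i a = Z? (g (ι i)) (vA a)

            WB? : ∀ j b → Dec (Z (h (κ j)) (vB c b))
            WB? j b = Z? (h (κ j)) (vB c b)

            located-small : ∀ i → card (λ a → locate WA? a ≟F suc i) ≤ kA
            located-small i = ≤-trans (sum-mono (λ a → ind-mono (locate WA? a ≟F suc i) (WA? i a) (locate-sound WA? a i))) (ι-small i)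

            located-small′ : ∀ j → card (λ b → locate WB? b ≟F suc j) ≤ kB
            located-small′ j = ≤-trans (sum-mono (λ b → ind-mono (locate WB? b ≟F suc j) (WB? j b) (locate-sound WB? b j))) (κ-small j)

            edge-between : ∀ i j → ∃₂ λ a b → Z (g (ι i)) (vA a) × Z (h (κ j)) (vB c b) × ω a b ≢ ρ b
            edge-between i j with edges (g (ι i)) (h (κ j)) (adjacent (ι i) (κ j))
            ... | u , v , zu , zv , e with one-copy (κ-avoidsA j) zv | view u in equ
            ...   | b , eqv | inj₁ a = a , b , to-vertex equ zu , to-vertex eqv zv , subst (Edge (inj₁ a)) eqv e
            -- An endpoint `u` in some copy would lie in copy `c`, which `g (ι i)` misses.
            ...   | b , eqv | inj₂ (i′ , b′) =
              contradiction (to-vertex (trans equ (cong (λ k → inj₂ (k , b′)) (proj₁ (subst (Edge (inj₂ (i′ , b′))) eqv e)))) zu)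
                            (ι-avoidsB i b′)

            small-families-clash : ⊥
            small-families-clash = pseudorandom (locate WA?) (locate WB?) ρ located-small located-small′ λ i j → found (edge-between i j)
              where
              found : ∀ {i j} → (∃₂ λ a b → Z (g (ι i)) (vA a) × Z (h (κ j)) (vB c b) × ω a b ≢ ρ b) →
                      ∃₂ λ a b → locate WA? a ≡ suc i × locate WB? b ≡ suc j × ω a b ≢ ρ b
              found {i} {j} (a , b , za , zb , ne) =
                a , b
                , locate-complete WA? (λ i i′ a z z′ → ι-injective i i′ (G.same _ _ (vA a) z z′)) a i za
                , locate-complete WB? (λ j j′ b z z′ → κ-injective j j′ (H.same _ _ (vB c b) z z′)) b j zb
                , ne

          -- Each side starts with `m + m` sets, and discarding the at most `m` large ones leaves
          -- `m`. Size is measured in the first clique on side `g` and in copy `c` on side `h`.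
          clash : m + m ≤ card (λ i → ¬? (G.MeetsB? c i)) → α + (m + m) ≤ ℓ₂ → ⊥
          clash manyG big
            with enumerate _ m (drop-large (λ i → ¬? (G.MeetsB? c i)) (λ i → suc kA ≤? G.A.size i) manyG
                   (G.A.few-large G.sum-sizeA≤ α-small))
               | enumerate _ m (drop-large (λ j → ¬? (H.MeetsA? j)) (λ j → suc kB ≤? H.B.size c j) (H.many-AvoidsA big)
                   (H.B.few-large c (H.sum-sizeB≤ c) β-small))
          ... | ι , all-ι , ι-injective | κ , all-κ , κ-injective =
            small-families-clash ι ι-injective κ κ-injective
              (λ i b z → proj₁ (all-ι i) (∃⇒card-positive (G.ZB? c (ι i)) (b , z)))
              (λ i → s≤s⁻¹ (≰⇒> (proj₂ (all-ι i))))
              (λ j → H.¬MeetsA⇒AvoidsA (proj₁ (all-κ j)))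
              (λ j → s≤s⁻¹ (≰⇒> (proj₂ (all-κ j))))

        left-injective : ∀ i j → left i ≡ left j → i ≡ j
        left-injective i j = ↑ˡ-injective t i j

        right-injective : ∀ i j → right i ≡ right j → i ≡ j
        right-injective i j = ↑ʳ-injective s i j

        module S = Side left left-injective
        module T = Side right right-injective
        module All = Side (λ f → f) (λ _ _ eq → eq)

        -- Every branch set avoiding the first clique is adjacent in `K s t` to `f₀` or `g₀`, which
        -- anchors all of them in one copy. Some side has `m + m` sets missing that copy and plays
        -- `g` in `Clash`.
        impossible-from : ∀ {f₀ g₀} → AvoidsA (left f₀) → AvoidsA (right g₀) → ⊥
        impossible-from {f₀} {g₀} avf₀ avg₀ = by-side (≤-total (m + m) cS)
          where
          home : ∃ λ c → InCopy c (proj₁ (nonempty (left f₀)))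
          home = avoidsA-view avf₀ (proj₂ (nonempty (left f₀)))
          c = proj₁ home

          f₀-home : ∀ {v} → Z (left f₀) v → InCopy c v
          f₀-home {v} z = walk-copy avf₀ (proj₂ home) (connected (left f₀) _ v (proj₂ (nonempty (left f₀))) z)

          g₀-home : ∀ {v} → Z (right g₀) v → InCopy c v
          g₀-home = neighbour-copy avf₀ avg₀ (left-right f₀ g₀) f₀-home

          one-copy : ∀ {f} → AvoidsA f → ∀ {v} → Z f v → InCopy c v
          one-copy {f} av with splitAt s f in eq
          ... | inj₁ i = neighbour-copy avg₀ av (subst (Adj (K s t) (right g₀)) (is-left eq) (Graph.sym (K s t) {left i} {right g₀} (left-right i g₀))) g₀-home
            where
            is-left : splitAt s f ≡ inj₁ i → left i ≡ f
            is-left eq = splitAt⁻¹-↑ˡ eq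
          ... | inj₂ j = neighbour-copy avf₀ av (subst (Adj (K s t) (left f₀)) (splitAt⁻¹-↑ʳ eq) (left-right f₀ j)) f₀-home

          cS = card (λ i → ¬? (S.MeetsB? c i))
          cT = card (λ j → ¬? (T.MeetsB? c j))
          tS = card (S.MeetsB? c)
          tT = card (T.MeetsB? c)

          touched : tS + tT ≤ β
          touched = begin
            tS + tT                      ≡⟨ sum-↑ {s} (λ f → ind (All.MeetsB? c f)) ⟨
            card (All.MeetsB? c)         ≡⟨ *-identityʳ _ ⟨
            card (All.MeetsB? c) * 1     ≤⟨ All.B.large*h≤ c 1 ⟩
            sum (All.B.size c)           ≤⟨ All.sum-sizeB≤ c ⟩
            β                            ∎
            where open ≤-Reasoning

          untouched : (m + m) + (m + m) ≤ cS + cT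
          untouched = +-cancelˡ-≤ β _ _ (begin
            β + ((m + m) + (m + m))      ≤⟨ s+t-big ⟩
            s + t                        ≤⟨ +-mono-≤ (card-complement (S.MeetsB? c)) (card-complement (T.MeetsB? c)) ⟩
            (cS + tS) + (cT + tT)        ≡⟨ interchange cS tS cT tT ⟩
            (cS + cT) + (tS + tT)        ≤⟨ +-monoʳ-≤ (cS + cT) touched ⟩
            (cS + cT) + β                ≡⟨ +-comm (cS + cT) β ⟩
            β + (cS + cT)                ∎)
            where
            open ≤-Reasoning
            interchange : ∀ a b c d → (a + b) + (c + d) ≡ (a + c) + (b + d)
            interchange = solve-∀

          by-side : (m + m ≤ cS) ⊎ (cS ≤ m + m) → ⊥
          by-side (inj₁ le) =
            Clash.clash left left-injective right right-injective left-right c one-copy le t-big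
          -- Of the `(m + m) + (m + m)` sets missing the copy at most `m + m` are on the left, so
          -- the right side has enough and the roles are swapped.
          by-side (inj₂ ge) =
            Clash.clash right right-injective left left-injective (λ j i → Graph.sym (K s t) {left i} {right j} (left-right i j)) c one-copy
              (+-cancelˡ-≤ (m + m) _ _ (≤-trans untouched (+-monoˡ-≤ cT ge))) s-big

        impossible : ⊥
        impossible = impossible-from (proj₂ (S.∃-AvoidsA s-big)) (proj₂ (T.∃-AvoidsA t-big))

    glued-minor-free : ¬ HasMinor glued (K s t)
    glued-minor-free model =
      ¬¬-∀ (λ f → ¬¬-∀ (λ v → ¬¬-excluded-middle)) (impossible model)

  -- Choice of parameters

  rare-value : ∀ {n} q-1 (f : Fin n → Fin (suc q-1)) → ∃ λ r → card (λ a → f a ≟F r) * suc q-1 ≤ n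
  -- Averaging yields a strict inequality; comparing with `suc n` turns it into the weak bound by
  -- `n`.
  rare-value {n} q-1 f with sum-average (λ r → card (λ a → f a ≟F r) * suc q-1) (suc n) total
    where
    open ≤-Reasoning
    total : sum (λ r → card (λ a → f a ≟F r) * suc q-1) < suc q-1 * suc n
    total = begin-strict
      sum (λ r → card (λ a → f a ≟F r) * suc q-1)
        ≡⟨ *-distribʳ-sum (suc q-1) (λ r → card (λ a → f a ≟F r)) ⟨
      sum (λ r → card (λ a → f a ≟F r)) * suc q-1
        ≤⟨ *-monoˡ-≤ (suc q-1) (Family.sum-size≤ (λ r a → f a ≟F r) (λ _ _ _ e e′ → trans (sym e) e′)) ⟩
      n * suc q-1       ≡⟨ *-comm n (suc q-1) ⟩
      suc q-1 * n       <⟨ *-monoʳ-< (suc q-1) (n<1+n n) ⟩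
      suc q-1 * suc n   ∎
  ... | r , lt = r , s≤s⁻¹ lt

  -- The palette has one colour fewer than the two cliques have vertices. As `α ≤ m * suc q-1`, the
  -- rare colour occurs at most `m` times in each row, so lists keep at least `p - m` colours.
  construction : ∀ q-1 m α β kA kB s t (ω : Fin α → Fin β → Fin (suc q-1)) → Pseudorandom q-1 m α β kA kB ω →
                 1 ≤ m → α + (m + m) ≡ s → β + ((m + m) + (m + m)) ≡ s + t → s ≤ t →
                 α ≤ m * suc q-1 → α ≤ m * suc kA → β ≤ m * suc kB →
                 Σ Graph λ G → ¬ HasMinor G (K s t) × (∀ k → k + m < α + β → ¬ Choosable G k)
  construction q-1 m α β kA kB s t ω pseudorandom m>0 α+ β+ s≤t α≤q α≤kA β≤kB =
    Gluing.glued α β p (agree? ω ρ)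
    , MinorFree.glued-minor-free q-1 m α β kA kB p s t ω ρ pseudorandom m>0
        (≤-reflexive α+) (≤-trans (≤-reflexive α+) s≤t) (≤-reflexive β+) α≤kA β≤kB
    , λ k lt → Gluing.glued-not-choosable α β p (agree? ω ρ) degree (∸-monoˡ-≤ 1 lt)
        (∸-monoʳ-< {α + β} {1} {0} (s≤s z≤n) (≤-trans (s≤s z≤n) lt))
    where
    p = α + β ∸ 1
    ρ : Fin β → Fin (suc q-1)
    ρ b = proj₁ (rare-value q-1 (λ a → ω a b))
    degree : ∀ b → card (λ a → agree? ω ρ a b) ≤ m
    degree b = *-cancelʳ-≤ _ m (suc q-1) (≤-trans (proj₂ (rare-value q-1 (λ a → ω a b))) α≤q)

  -- Elementary inequalities behind the union bound

  ^-distribˡ-* : ∀ n a b → (a * b) ^ n ≡ a ^ n * b ^ n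
  ^-distribˡ-* zero    a b = refl
  ^-distribˡ-* (suc n) a b = trans (cong (a * b *_) (^-distribˡ-* n a b)) (lemma a b (a ^ n) (b ^ n))
    where
    lemma : ∀ a b x y → a * b * (x * y) ≡ a * x * (b * y)
    lemma = solve-∀

  -- Bernoulli's inequality for `1 + 1/a`, multiplied by `a ^ suc n`.
  bernoulli : ∀ a n → a ^ n * (a + n) ≤ suc a ^ n * a
  bernoulli a zero    = ≤-reflexive (lemma a)
    where
    lemma : ∀ a → 1 * (a + 0) ≡ 1 * a
    lemma = solve-∀
  bernoulli a (suc n) = begin
    a * a ^ n * (a + suc n)             ≤⟨ m≤m+n _ (a ^ n * n) ⟩
    a * a ^ n * (a + suc n) + a ^ n * n ≡⟨ lemma a n (a ^ n) ⟩
    suc a * (a ^ n * (a + n))           ≤⟨ *-monoʳ-≤ (suc a) (bernoulli a n) ⟩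
    suc a * (suc a ^ n * a)             ≡⟨ *-assoc (suc a) (suc a ^ n) a ⟨
    suc a * suc a ^ n * a               ∎
    where
    open ≤-Reasoning
    lemma : ∀ a n x → a * x * (a + suc n) + x * n ≡ suc a * (x * (a + n))
    lemma = solve-∀

  -- Bernoulli with exponent `suc a` bounds the power of `1 + 1/a` below by `2 + 1/a`. The final
  -- cancellation of `a` is why zero is treated apart.
  doubling : ∀ a → 2 * a ^ suc a ≤ suc a ^ suc a
  doubling zero      = z≤n
  doubling a@(suc _) = *-cancelʳ-≤ (2 * a ^ suc a) (suc a ^ suc a) a (begin
    2 * a ^ suc a * a        ≤⟨ m≤m+n _ (a ^ suc a) ⟩
    2 * a ^ suc a * a + a ^ suc a ≡⟨ lemma a (a ^ suc a) ⟩
    a ^ suc a * (a + suc a)  ≤⟨ bernoulli a (suc a) ⟩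
    suc a ^ suc a * a        ∎)
    where
    open ≤-Reasoning
    lemma : ∀ a x → 2 * x * a + x ≡ x * (a + suc a)
    lemma = solve-∀

  n<2^n : ∀ n → n < 2 ^ n
  n<2^n zero    = s≤s z≤n
  n<2^n (suc n) = begin-strict
    suc n              <⟨ s≤s (n<2^n n) ⟩
    1 + 2 ^ n          ≤⟨ +-monoˡ-≤ (2 ^ n) (m^n>0 2 n) ⟩
    2 ^ n + 2 ^ n      ≡⟨ cong (2 ^ n +_) (+-identityʳ (2 ^ n)) ⟨
    2 ^ suc n          ∎
    where open ≤-Reasoning

  -- (1 + 1/a)^(1+a) ≥ 2 beats the linear factor once the exponent is a large multiple of 1 + a.
  linear<exponential : ∀ a q u l → suc (u * (suc a * 2)) * q ≤ l → 1 ≤ l → 1 ≤ a →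
                       suc (u * (suc a * (l + l))) * q * a ^ (suc a * (l + l)) < suc a ^ (suc a * (l + l))
  linear<exponential a q u l W≤l l>0 a>0 = begin-strict
    suc (u * (suc a * (l + l))) * q * a ^ (suc a * (l + l))
      <⟨ *-monoˡ-< (a ^ (suc a * (l + l))) {{m^n≢0 a (suc a * (l + l)) {{>-nonZero a>0}}}} small ⟩
    2 ^ (l + l) * a ^ (suc a * (l + l))
      ≡⟨ cong (2 ^ (l + l) *_) (^-*-assoc a (suc a) (l + l)) ⟨
    2 ^ (l + l) * (a ^ suc a) ^ (l + l)
      ≡⟨ ^-distribˡ-* (l + l) 2 (a ^ suc a) ⟨
    (2 * a ^ suc a) ^ (l + l)
      ≤⟨ ^-monoˡ-≤ (l + l) (doubling a) ⟩
    (suc a ^ suc a) ^ (l + l)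
      ≡⟨ ^-*-assoc (suc a) (suc a) (l + l) ⟩
    suc a ^ (suc a * (l + l)) ∎
    where
    open ≤-Reasoning
    expand : ∀ x q u l → (l + u * (x * (l + l))) * q ≡ (1 + u * (x * 2)) * q * l
    expand = solve-∀
    small : suc (u * (suc a * (l + l))) * q < 2 ^ (l + l)
    small = begin-strict
      -- Replacing 1 by `l` makes the expression a multiple of `l` whose other factor is at most `l`
      -- by `W≤l`.
      suc (u * (suc a * (l + l))) * q   ≤⟨ *-monoˡ-≤ q (+-monoˡ-≤ (u * (suc a * (l + l))) l>0) ⟩
      (l + u * (suc a * (l + l))) * q   ≡⟨ expand (suc a) q u l ⟩
      suc (u * (suc a * 2)) * q * l     ≤⟨ *-monoˡ-≤ l W≤l ⟩
      l * l                             <⟨ *-mono-< (n<2^n l) (n<2^n l) ⟩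
      2 ^ l * 2 ^ l                     ≡⟨ ^-distribˡ-+-* 2 l l ⟨
      2 ^ (l + l)                       ∎

  -- Since `m * m` is `M * (u * m)` and the number of triples is at most `(suc m * q) ^ (u * m)`,
  -- everything is a power with exponent `u * m` and only the bases have to be compared.
  union-bound-holds : ∀ Q q u l → 2 ≤ Q → 1 ≤ q → 1 ≤ u → 1 ≤ l → suc (u * (Q * 2)) * q ≤ l →
                      ∀ {m α β} → m ≡ u * (Q * (l + l)) → α + β ≤ u * m →
                      suc m ^ α * (suc m ^ β * q ^ β) * (Q ∸ 1) ^ (m * m) < Q ^ (m * m)
  union-bound-holds Q@(suc a) q u l Q≥2 q>0 u>0 l>0 W≤l {m} {α} {β} m≡ α+β≤ = begin-strict
    suc m ^ α * (suc m ^ β * q ^ β) * a ^ (m * m)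
      ≤⟨ *-monoˡ-≤ (a ^ (m * m)) events ⟩
    (suc m * q) ^ (u * m) * a ^ (m * m)
      ≡⟨ cong (λ z → (suc m * q) ^ (u * m) * a ^ z) split ⟩
    (suc m * q) ^ (u * m) * a ^ (M * (u * m))
      ≡⟨ cong ((suc m * q) ^ (u * m) *_) (^-*-assoc a M (u * m)) ⟨
    (suc m * q) ^ (u * m) * (a ^ M) ^ (u * m)
      ≡⟨ ^-distribˡ-* (u * m) (suc m * q) (a ^ M) ⟨
    (suc m * q * a ^ M) ^ (u * m)
      <⟨ ^-monoˡ-< (u * m) {{>-nonZero (*-mono-≤ u>0 m>0)}} base ⟩
    (Q ^ M) ^ (u * m)
      ≡⟨ ^-*-assoc Q M (u * m) ⟩
    Q ^ (M * (u * m))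
      ≡⟨ cong (Q ^_) split ⟨
    Q ^ (m * m) ∎
    where
    open ≤-Reasoning
    M = Q * (l + l)
    m>0 : 1 ≤ m
    m>0 = ≤-trans (*-mono-≤ u>0 (*-mono-≤ (≤-trans (s≤s z≤n) Q≥2) (≤-trans l>0 (m≤m+n l l)))) (≤-reflexive (sym m≡))
    split : m * m ≡ M * (u * m)
    split = trans (cong (_* m) (trans m≡ (*-comm u M))) (*-assoc M u m)
    base : suc m * q * a ^ M < Q ^ M
    base = subst (λ z → suc z * q * a ^ M < Q ^ M) (sym m≡) (linear<exponential a q u l W≤l l>0 (s≤s⁻¹ Q≥2))
    events : suc m ^ α * (suc m ^ β * q ^ β) ≤ (suc m * q) ^ (u * m)
    events = begin
      suc m ^ α * (suc m ^ β * q ^ β)      ≤⟨ *-monoˡ-≤ (suc m ^ β * q ^ β) (^-monoˡ-≤ α (m≤m*n (suc m) q {{>-nonZero q>0}})) ⟩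
      (suc m * q) ^ α * (suc m ^ β * q ^ β) ≡⟨ cong ((suc m * q) ^ α *_) (^-distribˡ-* β (suc m) q) ⟨
      (suc m * q) ^ α * (suc m * q) ^ β    ≡⟨ ^-distribˡ-+-* (suc m * q) α β ⟨
      (suc m * q) ^ (α + β)                ≤⟨ ^-monoʳ-≤ (suc m * q) {{>-nonZero (*-mono-≤ {1} {suc m} (s≤s z≤n) q>0)}} α+β≤ ⟩
      (suc m * q) ^ (u * m)                ∎

  -- It will turn out that `m * D ≤ s ≤ m * q` with `q` twice `D`, so `kA`, `kB` and `u` bound `s`,
  -- `s + t` and `s + (s + t)` in units of `m`. Rounding `s` down to a multiple of `M₀` gives `m`
  -- the shape required by the union bound, and `N` makes the multiplier at least `W`.
  module Parameters (D c : ℕ) (D≥3 : 3 ≤ D) where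

    q-1 q kA kB Q u W M₀ N : ℕ
    q-1 = D + D ∸ 1
    q   = suc q-1
    kA  = q
    kB  = suc c * q
    Q   = q ^ (kA * kB)
    u   = suc (suc c) * q
    W   = suc (u * (Q * 2)) * q
    M₀  = u * (Q * 2) * D
    N   = W * M₀

    q≡ : q ≡ D + D
    q≡ = m+[n∸m]≡n {1} (≤-trans (s≤s z≤n) (≤-trans D≥3 (m≤m+n D D)))

    D>0 : 1 ≤ D
    D>0 = ≤-trans (s≤s z≤n) D≥3

    q≥2 : 2 ≤ q
    q≥2 = ≤-trans (≤-trans (≤-trans (n≤1+n 2) D≥3) (m≤m+n D D)) (≤-reflexive (sym q≡))

    Q≥2 : 2 ≤ Q
    Q≥2 = ≤-trans q≥2 (≤-trans (≤-reflexive (sym (*-identityʳ q))) (^-monoʳ-≤ q (*-mono-≤ {1} {kA} {1} {kB} (s≤s z≤n) (s≤s z≤n))))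

    u>0 : 1 ≤ u
    u>0 = s≤s z≤n

    M₀>0 : 1 ≤ M₀
    M₀>0 = *-mono-≤ {1} {u * (Q * 2)} (*-mono-≤ u>0 (*-mono-≤ {1} {Q} (≤-trans (s≤s z≤n) Q≥2) (s≤s z≤n))) D>0

    instance
      M₀-nonZero : NonZero M₀
      M₀-nonZero = >-nonZero M₀>0

    module _ (s t : ℕ) (N≤s : N ≤ s) (s≤t : s ≤ t) (t≤cs : t ≤ c * s) where

      open ≤-Reasoning

      l m α β : ℕ
      l = s / M₀
      m = u * (Q * (l + l))
      α = s ∸ (m + m)
      β = s + t ∸ ((m + m) + (m + m))

      W≤l : W ≤ l
      W≤l = ≤-trans (≤-reflexive (sym (m*n/n≡m W M₀))) (/-monoˡ-≤ M₀ N≤s)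

      l>0 : 1 ≤ l
      l>0 = ≤-trans (*-mono-≤ {1} {suc (u * (Q * 2))} {1} {q} (s≤s z≤n) (s≤s z≤n)) W≤l

      m>0 : 1 ≤ m
      m>0 = *-mono-≤ u>0 (*-mono-≤ {1} {Q} (≤-trans (s≤s z≤n) Q≥2) (≤-trans l>0 (m≤m+n l l)))

      mD≡ : m * D ≡ l * M₀
      mD≡ = lemma u Q l D
        where
        lemma : ∀ u Q l D → u * (Q * (l + l)) * D ≡ l * (u * (Q * 2) * D)
        lemma = solve-∀

      mD≤s : m * D ≤ s
      mD≤s = ≤-trans (≤-reflexive mD≡) (m/n*n≤m s M₀)

      s≤mq : s ≤ m * q
      s≤mq = begin
        s                    ≡⟨ m≡m%n+[m/n]*n s M₀ ⟩
        s % M₀ + l * M₀      ≤⟨ +-monoˡ-≤ (l * M₀) (<⇒≤ (m%n<n s M₀)) ⟩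
        -- The remainder is below `M₀`, hence at most `l * M₀`; this rounding is the source of the
        -- factor 2 in `q`.
        M₀ + l * M₀          ≤⟨ +-monoˡ-≤ (l * M₀) (≤-trans (≤-reflexive (sym (*-identityˡ M₀))) (*-monoˡ-≤ M₀ l>0)) ⟩
        l * M₀ + l * M₀      ≡⟨ cong₂ _+_ mD≡ mD≡ ⟨
        m * D + m * D        ≡⟨ *-distribˡ-+ m D D ⟨
        m * (D + D)          ≡⟨ cong (m *_) q≡ ⟨
        m * q                ∎

      m+m+m≤s : m + m + m ≤ s
      m+m+m≤s = ≤-trans (≤-reflexive (lemma m)) (≤-trans (*-monoʳ-≤ m D≥3) mD≤s)
        where
        lemma : ∀ m → m + m + m ≡ m * 3
        lemma = solve-∀

      m+m≤s : m + m ≤ s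
      m+m≤s = ≤-trans (m≤m+n (m + m) m) m+m+m≤s

      4m≤s+t : (m + m) + (m + m) ≤ s + t
      4m≤s+t = +-mono-≤ m+m≤s (≤-trans m+m≤s s≤t)

      s+t≤ : s + t ≤ m * kB
      s+t≤ = begin
        s + t             ≤⟨ +-monoʳ-≤ s t≤cs ⟩
        suc c * s         ≤⟨ *-monoʳ-≤ (suc c) s≤mq ⟩
        suc c * (m * q)   ≡⟨ lemma (suc c) m q ⟩
        m * (suc c * q)   ∎
        where
        lemma : ∀ a b c → a * (b * c) ≡ b * (a * c)
        lemma = solve-∀

      α+β≤ : α + β ≤ u * m
      α+β≤ = begin
        α + β             ≤⟨ +-mono-≤ (m∸n≤m s (m + m)) (m∸n≤m (s + t) ((m + m) + (m + m))) ⟩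
        s + (s + t)       ≤⟨ +-mono-≤ s≤mq s+t≤ ⟩
        m * q + m * kB    ≡⟨ lemma m q c ⟩
        u * m             ∎
        where
        lemma : ∀ m q c → m * q + m * ((1 + c) * q) ≡ (2 + c) * q * m
        lemma = solve-∀

      α+ : α + (m + m) ≡ s
      α+ = m∸n+n≡m m+m≤s

      β+ : β + ((m + m) + (m + m)) ≡ s + t
      β+ = m∸n+n≡m 4m≤s+t

      few : suc m ^ α * (suc m ^ β * q ^ β) * (Q ∸ 1) ^ (m * m) < Q ^ (m * m)
      few = union-bound-holds Q q u l Q≥2 (s≤s z≤n) u>0 l>0 W≤l {m} {α} {β} refl α+β≤

      graph : Σ Graph λ G → ¬ HasMinor G (K s t) × (∀ k → k + m < α + β → ¬ Choosable G k)
      graph = construction q-1 m α β kA kB s t (proj₁ ω) (proj₂ ω) m>0 α+ β+ s≤t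
        (≤-trans (m∸n≤m s (m + m)) s≤mq)
        (≤-trans (m∸n≤m s (m + m)) (≤-trans s≤mq (*-monoʳ-≤ m (n≤1+n q))))
        (≤-trans (m∸n≤m (s + t) ((m + m) + (m + m))) (≤-trans s+t≤ (*-monoʳ-≤ m (n≤1+n kB))))
        where
        ω = pseudorandom-exists q-1 m α β kA kB few

      -- Of the eight `m`, six are lost in shrinking `α` and `β`, one in the lists, and the last
      -- makes the inequality strict.
      enough : ∀ k → k + 8 * m ≤ 2 * s + t → k + m < α + β
      enough k le = +-cancelʳ-< (6 * m) (k + m) (α + β) (begin-strict
        k + m + 6 * m       <⟨ m<m+n (k + m + 6 * m) m>0 ⟩
        k + m + 6 * m + m   ≡⟨ lemma₁ k m ⟩
        k + 8 * m           ≤⟨ le ⟩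
        2 * s + t           ≡⟨ lemma₂ s t ⟩
        s + (s + t)         ≡⟨ cong₂ _+_ α+ β+ ⟨
        (α + (m + m)) + (β + ((m + m) + (m + m))) ≡⟨ lemma₃ α β m ⟩
        α + β + 6 * m       ∎)
        where
        lemma₁ : ∀ k m → k + m + 6 * m + m ≡ k + 8 * m
        lemma₁ = solve-∀
        lemma₂ : ∀ s t → 2 * s + t ≡ s + (s + t)
        lemma₂ = solve-∀
        lemma₃ : ∀ α β m → (α + (m + m)) + (β + ((m + m) + (m + m))) ≡ α + β + 6 * m
        lemma₃ = solve-∀

  -- The result over the naturals: the loss `8 * m` is at most `8 / D` times `s`.
  woodall-fails : ∀ D c → 3 ≤ D → ∃ λ N → ∀ s t → N ≤ s → s ≤ t → t ≤ c * s →
                  ∃ λ m → m * D ≤ s × Σ Graph λ G →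
                  ¬ HasMinor G (K s t) × (∀ k → k + 8 * m ≤ 2 * s + t → ¬ Choosable G k)
  woodall-fails D c D≥3 = N , λ s t N≤s s≤t t≤cs →
    let G , minor-free , not-choosable = graph s t N≤s s≤t t≤cs
    in m s t N≤s s≤t t≤cs , mD≤s s t N≤s s≤t t≤cs , G , minor-free
       , λ k le → not-choosable k (enough s t N≤s s≤t t≤cs k le)
    where open Parameters D c D≥3

-- Transfer to rational constants

open import Defs
open import Data.Nat using (ℕ; _≤_)
open import Data.Product using (Σ; _×_)
open import Relation.Nullary using (¬_)
open import Data.Rational using (ℚ; 0ℚ; 1ℚ; _<_; _-_; _*_; _+_) renaming (_≤_ to _≤ℚ_)
import Data.Nat as ℕ
import Data.Nat.Properties as ℕ
import Data.Integer as ℤ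
import Data.Integer.Properties as ℤ
import Data.Rational as ℚ
import Data.Rational.Properties as ℚ
import Data.Rational.Unnormalised as ℚᵘ
import Data.Rational.Unnormalised.Properties as ℚᵘ
open import Data.Rational.Unnormalised using (mkℚᵘ)
open import Data.Nat.Tactic.RingSolver using (solve-∀)
open import Data.Product using (_,_; proj₁; proj₂; ∃)
import Relation.Binary.PropositionalEquality as ≡
open ≡ using (_≡_)
open import Relation.Nullary using (contradiction; yes; no)

-- `ℕtoℚ` normalises its result, so arithmetic is done on unnormalised fractions; the 0 in `mkℚᵘ`
-- stands for denominator 1.
toℚᵘ-ℕ : ∀ m → ℚ.toℚᵘ (ℕtoℚ m) ℚᵘ.≃ mkℚᵘ (ℤ.+ m) 0
toℚᵘ-ℕ m = ℚ.toℚᵘ-fromℚᵘ (mkℚᵘ (ℤ.+ m) 0)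

ℕtoℚ-+ : ∀ m n → ℕtoℚ (m ℕ.+ n) ≡ ℕtoℚ m + ℕtoℚ n
ℕtoℚ-+ m n = ℚ.toℚᵘ-injective (begin-equality
  ℚ.toℚᵘ (ℕtoℚ (m ℕ.+ n))                        ≃⟨ toℚᵘ-ℕ (m ℕ.+ n) ⟩
  mkℚᵘ (ℤ.+ (m ℕ.+ n)) 0                         ≃⟨ ℚᵘ.*≡* (≡.cong (ℤ._* ℤ.1ℤ) (≡.cong₂ ℤ._+_ (≡.sym (ℤ.*-identityʳ (ℤ.+ m))) (≡.sym (ℤ.*-identityʳ (ℤ.+ n))))) ⟩
  mkℚᵘ (ℤ.+ m) 0 ℚᵘ.+ mkℚᵘ (ℤ.+ n) 0             ≃⟨ ℚᵘ.+-cong (toℚᵘ-ℕ m) (toℚᵘ-ℕ n) ⟨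
  ℚ.toℚᵘ (ℕtoℚ m) ℚᵘ.+ ℚ.toℚᵘ (ℕtoℚ n)           ≃⟨ ℚ.toℚᵘ-homo-+ (ℕtoℚ m) (ℕtoℚ n) ⟨
  ℚ.toℚᵘ (ℕtoℚ m + ℕtoℚ n)                       ∎)
  where open ℚᵘ.≤-Reasoning

ℕtoℚ-* : ∀ m n → ℕtoℚ (m ℕ.* n) ≡ ℕtoℚ m * ℕtoℚ n
ℕtoℚ-* m n = ℚ.toℚᵘ-injective (begin-equality
  ℚ.toℚᵘ (ℕtoℚ (m ℕ.* n))                        ≃⟨ toℚᵘ-ℕ (m ℕ.* n) ⟩
  mkℚᵘ (ℤ.+ (m ℕ.* n)) 0                         ≃⟨ ℚᵘ.*≡* (≡.cong (ℤ._* ℤ.1ℤ) (ℤ.pos-* m n)) ⟩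
  mkℚᵘ (ℤ.+ m) 0 ℚᵘ.* mkℚᵘ (ℤ.+ n) 0             ≃⟨ ℚᵘ.*-cong (toℚᵘ-ℕ m) (toℚᵘ-ℕ n) ⟨
  ℚ.toℚᵘ (ℕtoℚ m) ℚᵘ.* ℚ.toℚᵘ (ℕtoℚ n)           ≃⟨ ℚ.toℚᵘ-homo-* (ℕtoℚ m) (ℕtoℚ n) ⟨
  ℚ.toℚᵘ (ℕtoℚ m * ℕtoℚ n)                       ∎)
  where open ℚᵘ.≤-Reasoning

ℕtoℚ-mono-≤ : ∀ {m n} → m ≤ n → ℕtoℚ m ≤ℚ ℕtoℚ n
ℕtoℚ-mono-≤ {m} {n} m≤n = ℚ.toℚᵘ-cancel-≤ (begin
  ℚ.toℚᵘ (ℕtoℚ m)      ≃⟨ toℚᵘ-ℕ m ⟩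
  mkℚᵘ (ℤ.+ m) 0       ≤⟨ ℚᵘ.*≤* (ℤ.*-monoʳ-≤-nonNeg ℤ.1ℤ (ℤ.+≤+ m≤n)) ⟩
  mkℚᵘ (ℤ.+ n) 0       ≃⟨ toℚᵘ-ℕ n ⟨
  ℚ.toℚᵘ (ℕtoℚ n)      ∎)
  where open ℚᵘ.≤-Reasoning

ℕtoℚ-mono-< : ∀ {m n} → m ℕ.< n → ℕtoℚ m < ℕtoℚ n
ℕtoℚ-mono-< {m} {n} m<n = ℚ.toℚᵘ-cancel-< (begin-strict
  ℚ.toℚᵘ (ℕtoℚ m)      ≃⟨ toℚᵘ-ℕ m ⟩
  mkℚᵘ (ℤ.+ m) 0       <⟨ ℚᵘ.*<* (ℤ.*-monoʳ-<-pos ℤ.1ℤ (ℤ.+<+ m<n)) ⟩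
  mkℚᵘ (ℤ.+ n) 0       ≃⟨ toℚᵘ-ℕ n ⟨
  ℚ.toℚᵘ (ℕtoℚ n)      ∎)
  where open ℚᵘ.≤-Reasoning

ℕtoℚ-cancel-≤ : ∀ {m n} → ℕtoℚ m ≤ℚ ℕtoℚ n → m ≤ n
ℕtoℚ-cancel-≤ {m} {n} le with m ℕ.≤? n
... | yes m≤n = m≤n
... | no  m≰n = contradiction (ℚ.≤-<-trans le (ℕtoℚ-mono-< (ℕ.≰⇒> m≰n))) (ℚ.<-irrefl ≡.refl)

-- The absolute value of the numerator works, as the denominator is at least 1.
archimedean : ∀ C → ∃ λ c → C ≤ℚ ℕtoℚ c
archimedean C@(ℚ.mkℚ num den _) = ℤ.∣ num ∣ , ℚ.toℚᵘ-cancel-≤ (begin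
  ℚ.toℚᵘ C                          ≤⟨ ℚᵘ.*≤* (by num) ⟩
  mkℚᵘ (ℤ.+ ℤ.∣ num ∣) 0            ≃⟨ toℚᵘ-ℕ ℤ.∣ num ∣ ⟨
  ℚ.toℚᵘ (ℕtoℚ ℤ.∣ num ∣)           ∎)
  where
  open ℚᵘ.≤-Reasoning
  by : ∀ z → z ℤ.* ℤ.1ℤ ℤ.≤ ℤ.+ ℤ.∣ z ∣ ℤ.* ℤ.+ (ℕ.suc den)
  by (ℤ.+ a)      = ≡.subst₂ ℤ._≤_ (ℤ.pos-* a 1) (ℤ.pos-* a (ℕ.suc den)) (ℤ.+≤+ (ℕ.*-monoʳ-≤ a (ℕ.s≤s ℕ.z≤n)))
  by (ℤ.-[1+ a ]) = ℤ.-≤+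

-- The denominator works, as the numerator is at least 1.
reciprocal-bound : ∀ ε → 0ℚ < ε → ∃ λ e → 1 ≤ e × 1ℚ ≤ℚ ε * ℕtoℚ e
reciprocal-bound ε@(ℚ.mkℚ (ℤ.+ ℕ.suc a) den _) _ = ℕ.suc den , ℕ.s≤s ℕ.z≤n , ℚ.toℚᵘ-cancel-≤ (begin
  mkℚᵘ ℤ.1ℤ 0                                         ≤⟨ ℚᵘ.*≤* le ⟩
  ℚ.toℚᵘ ε ℚᵘ.* mkℚᵘ (ℤ.+ ℕ.suc den) 0                ≃⟨ ℚᵘ.*-congˡ {ℚ.toℚᵘ ε} (toℚᵘ-ℕ (ℕ.suc den)) ⟨
  ℚ.toℚᵘ ε ℚᵘ.* ℚ.toℚᵘ (ℕtoℚ (ℕ.suc den))             ≃⟨ ℚ.toℚᵘ-homo-* ε (ℕtoℚ (ℕ.suc den)) ⟨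
  ℚ.toℚᵘ (ε * ℕtoℚ (ℕ.suc den))                       ∎)
  where
  open ℚᵘ.≤-Reasoning
  le : ℤ.1ℤ ℤ.* (ℤ.+ (ℕ.suc den ℕ.* 1)) ℤ.≤ (ℤ.+ ℕ.suc a ℤ.* ℤ.+ ℕ.suc den) ℤ.* ℤ.1ℤ
  le = ≡.subst₂ ℤ._≤_ (≡.sym (ℤ.*-identityˡ (ℤ.+ (ℕ.suc den ℕ.* 1)))) (≡.sym (ℤ.*-identityʳ (ℤ.+ ℕ.suc a ℤ.* ℤ.+ ℕ.suc den)))
         (ℤ.+≤+ (ℕ.≤-trans (ℕ.≤-reflexive (ℕ.*-identityʳ (ℕ.suc den))) (ℕ.m≤n*m (ℕ.suc den) (ℕ.suc a))))
reciprocal-bound (ℚ.mkℚ (ℤ.+ 0)    _ _) (ℚ.*<* (ℤ.+<+ ()))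
reciprocal-bound (ℚ.mkℚ ℤ.-[1+ _ ] _ _) (ℚ.*<* ())

-- Here `d ≤ x / e ≤ ε * x`, so `x < k + d` becomes `x < k + ε * x`.
scaled-gap : ∀ ε e x k d → 0ℚ < ε → 1ℚ ≤ℚ ε * ℕtoℚ e → e ℕ.* d ≤ x → x ℕ.< k ℕ.+ d → (1ℚ - ε) * ℕtoℚ x < ℕtoℚ k
scaled-gap ε e x k d ε>0 1≤εe ed≤x x<k+d = begin-strict
  (1ℚ - ε) * X                 ≡⟨ ℚ.*-distribʳ-+ X 1ℚ (ℚ.- ε) ⟩
  1ℚ * X + (ℚ.- ε) * X         ≡⟨ ≡.cong₂ _+_ (ℚ.*-identityˡ X) (≡.sym (ℚ.neg-distribˡ-* ε X)) ⟩
  X - ε * X                    <⟨ ℚ.+-monoˡ-< (ℚ.- (ε * X)) below ⟩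
  (ℕtoℚ k + ε * X) - ε * X     ≡⟨ ℚ.+-assoc (ℕtoℚ k) (ε * X) (ℚ.- (ε * X)) ⟩
  ℕtoℚ k + (ε * X - ε * X)     ≡⟨ ≡.cong (ℕtoℚ k +_) (ℚ.+-inverseʳ (ε * X)) ⟩
  ℕtoℚ k + 0ℚ                  ≡⟨ ℚ.+-identityʳ (ℕtoℚ k) ⟩
  ℕtoℚ k                       ∎
  where
  open ℚ.≤-Reasoning
  X = ℕtoℚ x
  instance
    _ = ℚ.nonNegative (ℚ.<⇒≤ ε>0)
    _ = ℚ.nonNegative (ℕtoℚ-mono-≤ {0} {d} ℕ.z≤n)
  below : X < ℕtoℚ k + ε * X
  below = begin-strict
    X                                   <⟨ ℕtoℚ-mono-< x<k+d ⟩
    ℕtoℚ (k ℕ.+ d)                      ≡⟨ ℕtoℚ-+ k d ⟩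
    ℕtoℚ k + ℕtoℚ d                     ≡⟨ ≡.cong (ℕtoℚ k +_) (ℚ.*-identityˡ (ℕtoℚ d)) ⟨
    ℕtoℚ k + 1ℚ * ℕtoℚ d                ≤⟨ ℚ.+-monoʳ-≤ (ℕtoℚ k) (ℚ.*-monoʳ-≤-nonNeg (ℕtoℚ d) 1≤εe) ⟩
    ℕtoℚ k + ε * ℕtoℚ e * ℕtoℚ d        ≡⟨ ≡.cong (ℕtoℚ k +_) (≡.trans (ℚ.*-assoc ε (ℕtoℚ e) (ℕtoℚ d)) (≡.cong (ε *_) (≡.sym (ℕtoℚ-* e d)))) ⟩
    ℕtoℚ k + ε * ℕtoℚ (e ℕ.* d)         ≤⟨ ℚ.+-monoʳ-≤ (ℕtoℚ k) (ℚ.*-monoˡ-≤-nonNeg ε (ℕtoℚ-mono-≤ ed≤x)) ⟩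
    ℕtoℚ k + ε * X                      ∎

-- `8 * e * m` is at most `9 * e * m`, which is three times a quantity bounded by `s`.
gap : ∀ e s t m → s ≤ t → m ℕ.* (3 ℕ.* e) ≤ s → e ℕ.* (8 ℕ.* m) ≤ 2 ℕ.* s ℕ.+ t
gap e s t m s≤t 3em≤s = begin
  e ℕ.* (8 ℕ.* m)                   ≤⟨ ℕ.m≤m+n _ (e ℕ.* m) ⟩
  e ℕ.* (8 ℕ.* m) ℕ.+ e ℕ.* m       ≡⟨ rearrange e m ⟩
  3 ℕ.* (m ℕ.* (3 ℕ.* e))           ≤⟨ ℕ.*-monoʳ-≤ 3 3em≤s ⟩
  3 ℕ.* s                           ≡⟨ split s ⟩
  2 ℕ.* s ℕ.+ s                     ≤⟨ ℕ.+-monoʳ-≤ (2 ℕ.* s) s≤t ⟩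
  2 ℕ.* s ℕ.+ t                     ∎
  where
  open ℕ.≤-Reasoning
  rearrange : ∀ e m → e ℕ.* (8 ℕ.* m) ℕ.+ e ℕ.* m ≡ 3 ℕ.* (m ℕ.* (3 ℕ.* e))
  rearrange = solve-∀
  split : ∀ s → 3 ℕ.* s ≡ 2 ℕ.* s ℕ.+ s
  split = solve-∀

≤-cleared : ∀ {C} c s t → C ≤ℚ ℕtoℚ c → ℕtoℚ t ≤ℚ C * ℕtoℚ s → t ≤ c ℕ.* s
≤-cleared {C} c s t C≤c t≤Cs = ℕtoℚ-cancel-≤ (begin
  ℕtoℚ t               ≤⟨ t≤Cs ⟩
  C * ℕtoℚ s           ≤⟨ ℚ.*-monoʳ-≤-nonNeg (ℕtoℚ s) {{ℚ.nonNegative (ℕtoℚ-mono-≤ {0} {s} ℕ.z≤n)}} C≤c ⟩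
  ℕtoℚ c * ℕtoℚ s      ≡⟨ ℕtoℚ-* c s ⟨
  ℕtoℚ (c ℕ.* s)       ∎)
  where open ℚ.≤-Reasoning

theorem1 : (ε C : ℚ) → 0ℚ < ε → 1ℚ ≤ℚ C →
    Σ ℕ λ N → (s t : ℕ) → N ≤ s → s ≤ t → ℕtoℚ t ≤ℚ C * ℕtoℚ s →
    Σ Graph λ G → ¬ HasMinor G (K s t) ×
    (∀ k → IsListChromaticNumber G k →
    (1ℚ - ε) * (ℕtoℚ (2 Data.Nat.* s) + ℕtoℚ t) < ℕtoℚ k)
theorem1 ε C ε>0 _ with reciprocal-bound ε ε>0 | archimedean C
... | e , e>0 , 1≤εe | c , C≤c = proj₁ large , λ s t N≤s s≤t t≤Cs →
  let m , 3em≤s , G , minor-free , not-choosable = proj₂ large s t N≤s s≤t (≤-cleared c s t C≤c t≤Cs)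
  in G , minor-free , λ k χ → ≡.subst (λ x → (1ℚ - ε) * x < ℕtoℚ k) (ℕtoℚ-+ (2 ℕ.* s) t)
       (scaled-gap ε e (2 ℕ.* s ℕ.+ t) k (8 ℕ.* m) ε>0 1≤εe (gap e s t m s≤t 3em≤s)
         -- If `k + 8 * m ≤ 2 * s + t`, the choosability contained in `χ` would be contradicted.
         (ℕ.≰⇒> (λ le → not-choosable k le (proj₁ (proj₂ χ)))))
  where
  -- `D` is `3 * e`, which is at least 3 and lets `gap` absorb the loss of `8 * m`.
  large = Combinatorics.woodall-fails (3 ℕ.* e) c (ℕ.*-monoʳ-≤ 3 e>0)
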